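{- Let $\mathcal{P}$ be a bilateral, local parking procedure. Then for every $r\geq 1$, the number of $\mathcal{P}$-parking functions of length $r$ is $(r+1)^{r-1}$.
   Context: $\mathbb{Z}^*$ denotes the set of finite words with letters in $\mathbb{Z}$, $\epsilon$ is the empty word, and $\mathrm{Fin}(\mathbb{Z})$ is the set of finite subsets of $\mathbb{Z}$. A parking procedure is a function $\mathcal{P}:\mathbb{Z}^*\to\mathrm{Fin}(\mathbb{Z})$ with $\mathcal{P}(\epsilon)=\emptyset$ such that for every word $a_1\cdots a_r$ with $r\ge 1$: (1) $\mathcal{P}(a_1\cdots a_r)$ has cardinality $r$, and $\mathcal{P}(a_1\cdots a_i)\subset\mathcal{P}(a_1\cdots a_{i+1})$ for all $i<r$; (2) if $a_r\notin\mathcal{P}(a_1\cdots a_{r-1})$ then $\mathcal{P}(a_1\cdots a_r)=\mathcal{P}(a_1\cdots a_{r-1})\sqcup\{a_r\}$. For a nonempty word, $\mathrm{ls}_{\mathcal{P}}(a_1\cdots a_i)$ is the unique element of $\mathcal{P}(a_1\cdots a_i)\setminus\mathcal{P}(a_1\cdots a_{i-1})$ (the spot where the $i$th car parks). A block of a set $S\subset\mathbb{Z}$ is a maximal (for inclusion) nonempty interval $\{t,t+1,\ldots,u\}$ of consecutive integers contained in $S$. $\mathcal{P}$ is bilateral if for every word $W$ and letter $a\in\mathcal{P}(W)$, if $\{t,\ldots,u\}$ is the block of $\mathcal{P}(W)$ containing $a$, then $\mathrm{ls}_{\mathcal{P}}(Wa)\in\{t-1,u+1\}$. Let $\tau:i\mapsto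 i+1$ on $\mathbb{Z}$, applied elementwise to subsets of $\mathbb{Z}$ and letterwise to words. $\mathcal{P}$ is shift invariant if $\mathcal{P}(\tau(W))=\tau(\mathcal{P}(W))$ for every word $W$. For $I\subset\mathcal{P}(W)$ with $W=a_1\cdots a_r$, $W_{|I}$ is the subword of $W$ formed by the letters $a_i$ such that the $i$th car parked in $I$, i.e. $\mathrm{ls}_{\mathcal{P}}(a_1\cdots a_i)\in I$. $\mathcal{P}$ is locally decided if for every word $W$, letter $a$, and block $I$ of $\mathcal{P}(W)$ with $a\in I$, one has $\mathrm{ls}_{\mathcal{P}}(Wa)=\mathrm{ls}_{\mathcal{P}}(W_{|I}a)$. $\mathcal{P}$ is local if it is both shift invariant and locally decided. A word $a_1\cdots a_r$ is a $\mathcal{P}$-parking function (of length $r$) if $\mathcal{P}(a_1\cdots a_r)=\{1,\ldots,r\}$. -}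

module Defs where

open import Data.Integer.Base as ℤ using (ℤ; +_; 1ℤ)
import Data.Integer.Properties as ℤ
open import Data.List.Base using (List; []; _∷_; _++_; _∷ʳ_; map; length)
open import Data.List.Membership.Propositional using (_∈_; _∉_; find; lose)
import Data.List.Membership.DecPropositional as DecMembership
open import Data.List.Membership.Propositional.Properties
  using (∈-++⁺ˡ; ∈-++⁺ʳ; ∈-++⁻; ∈-∃++)
open import Data.List.Properties using (length-++; length-++-sucʳ)
open import Data.List.Relation.Unary.All as All using (All; []; _∷_)
open import Data.List.Relation.Unary.AllPairs using ([]; _∷_)
open import Data.List.Relation.Unary.Any as Any using (here; there)
open import Data.List.Relation.Unary.Unique.Propositional using (Unique)
open import Data.List.Relation.Unary.Unique.Propositional.Properties using (map⁺)
open import Data.Nat.Base as ℕ using (ℕ; suc; z≤n; s≤s)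
import Data.Nat.Properties as ℕ
open import Data.Product using (∃!; ∃-syntax; _×_; _,_; proj₁)
open import Data.Sum.Base using (_⊎_; inj₁; inj₂)
open import Level using (0ℓ)
open import Relation.Binary.PropositionalEquality
  using (_≡_; _≢_; refl; sym; trans; cong; subst)
open import Relation.Nullary using (¬_; yes; no; contradiction)
open import Relation.Nullary.Decidable using (_×-dec_; ¬?; decidable-stable)
open import Relation.Unary using (Pred; Decidable; _⊆_; _≐_; _∪_; ∅; ｛_｝)

open DecMembership ℤ._≟_ using (_∈?_)

-- A finite set is listed without repetition, so the order of the list is
-- irrelevant data: sets are compared by _≐_ on the predicates ⟦_⟧, never by _≡_.
record FinSet (A : Set) : Set where
  field
    elements : List A
    unique   : Unique elements

open FinSet public

⟦_⟧ : ∀ {A} → FinSet A → Pred A 0ℓ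
⟦ S ⟧ x = x ∈ elements S

∣_∣ : ∀ {A} → FinSet A → ℕ
∣ S ∣ = length (elements S)

HasCardinality : ∀ {A} → Pred A 0ℓ → ℕ → Set
HasCardinality {A} P n = ∃[ S ] ⟦ S ⟧ ≐ P × ∣ S ∣ ≡ n

Word : Set
Word = List ℤ

suc-injective : ∀ {i j} → ℤ.suc i ≡ ℤ.suc j → i ≡ j
suc-injective {i} {j} eq =
  trans (sym (ℤ.pred-suc i)) (trans (cong ℤ.pred eq) (ℤ.pred-suc j))

τ-set : FinSet ℤ → FinSet ℤ
τ-set S = record
  { elements = map ℤ.suc (elements S)
  ; unique   = map⁺ suc-injective (unique S)
  }

τ-word : Word → Word
τ-word = map ℤ.suc

[_⋯_] : ℤ → ℤ → Pred ℤ 0ℓ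
[ t ⋯ u ] x = t ℤ.≤ x × x ℤ.≤ u

[_⋯_]? : ∀ t u → Decidable [ t ⋯ u ]
[ t ⋯ u ]? x = (t ℤ.≤? x) ×-dec (x ℤ.≤? u)

record IsBlock (S : Pred ℤ 0ℓ) (t u : ℤ) : Set where
  field
    nonempty  : t ℤ.≤ u
    contained : [ t ⋯ u ] ⊆ S
    maximal   : ∀ {t′ u′} → [ t ⋯ u ] ⊆ [ t′ ⋯ u′ ] → [ t′ ⋯ u′ ] ⊆ S →
                [ t′ ⋯ u′ ] ⊆ [ t ⋯ u ]

-- A nonempty word a₁⋯aᵣ is written W ∷ʳ a with W = a₁⋯aᵣ₋₁ and a = aᵣ.
record ParkingProcedure : Set where
  field
    park     : Word → FinSet ℤ
    park-ε   : ⟦ park [] ⟧ ≐ ∅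
    card     : ∀ W → ∣ park W ∣ ≡ length W
    monotone : ∀ W a → ⟦ park W ⟧ ⊆ ⟦ park (W ∷ʳ a) ⟧
    lucky    : ∀ W a → ¬ ⟦ park W ⟧ a →
               ⟦ park (W ∷ʳ a) ⟧ ≐ ⟦ park W ⟧ ∪ ｛ a ｝

unique-⊆⇒length-≤ : ∀ {A : Set} {xs ys : List A} → Unique xs →
                    (_∈ xs) ⊆ (_∈ ys) → length xs ℕ.≤ length ys
unique-⊆⇒length-≤ {xs = []} _ _ = z≤n
unique-⊆⇒length-≤ {xs = x ∷ xs} (x∉xs ∷ uniq) sub with ∈-∃++ (sub (here refl))
... | ys , zs , refl =
  subst (suc (length xs) ℕ.≤_) (sym (length-++-sucʳ ys x zs))
    (s≤s (unique-⊆⇒length-≤ uniq avoid))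
  where
  avoid : (_∈ xs) ⊆ (_∈ (ys ++ zs))
  avoid y∈xs with ∈-++⁻ ys (sub (there y∈xs))
  ... | inj₁ y∈ys         = ∈-++⁺ˡ y∈ys
  ... | inj₂ (here refl)  = contradiction refl (All.lookup x∉xs y∈xs)
  ... | inj₂ (there y∈zs) = ∈-++⁺ʳ ys y∈zs

module _ (𝒫 : ParkingProcedure) where
  open ParkingProcedure 𝒫

  private
    card-suc : ∀ W a → ∣ park (W ∷ʳ a) ∣ ≡ suc ∣ park W ∣
    card-suc W a = trans (card (W ∷ʳ a))
      (trans (length-++ W) (trans (ℕ.+-comm (length W) 1) (cong suc (sym (card W)))))

    ∉⇒All≢ : ∀ {x : ℤ} {xs} → x ∉ xs → All (x ≢_) xs
    ∉⇒All≢ x∉xs = All.tabulate λ y∈xs → λ { refl → x∉xs y∈xs }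

    Newly : Word → ℤ → Pred ℤ 0ℓ
    Newly W a x = ⟦ park (W ∷ʳ a) ⟧ x × ¬ ⟦ park W ⟧ x

    newly-unique : ∀ W a {x y} → Newly W a x → Newly W a y → x ≡ y
    newly-unique W a {x} {y} (x∈ , x∉) (y∈ , y∉) with x ℤ.≟ y
    ... | yes x≡y = x≡y
    ... | no  x≢y = contradiction
      (unique-⊆⇒length-≤ ((x≢y ∷ ∉⇒All≢ x∉) ∷ ∉⇒All≢ y∉ ∷ unique (park W)) sub)
      (ℕ.<⇒≱ (ℕ.≤-reflexive (cong suc (card-suc W a))))
      where
      sub : (_∈ (x ∷ y ∷ elements (park W))) ⊆ ⟦ park (W ∷ʳ a) ⟧
      sub (here refl)         = x∈
      sub (there (here refl)) = y∈
      sub (there (there z∈))  = monotone W a z∈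

  ls-∃! : ∀ W a → ∃! _≡_ λ x → ⟦ park (W ∷ʳ a) ⟧ x × ¬ ⟦ park W ⟧ x
  ls-∃! W a with Any.any? (λ x → ¬? (x ∈? elements (park W))) (elements (park (W ∷ʳ a)))
  ... | yes found = let x , new = find found in x , new , newly-unique W a new
  ... | no  none  = contradiction
    (unique-⊆⇒length-≤ (unique (park (W ∷ʳ a))) sub)
    (ℕ.<⇒≱ (ℕ.≤-reflexive (sym (card-suc W a))))
    where
    sub : ⟦ park (W ∷ʳ a) ⟧ ⊆ ⟦ park W ⟧
    sub {x} x∈ = decidable-stable (x ∈? elements (park W)) λ x∉ → none (lose x∈ x∉)

  -- The spot where the last car of the word W ∷ʳ a parks.
  ls : Word → ℤ → ℤ
  ls W a = proj₁ (ls-∃! W a)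

  Bilateral : Set
  Bilateral = ∀ W a t u → IsBlock ⟦ park W ⟧ t u → [ t ⋯ u ] a →
              ls W a ≡ ℤ.pred t ⊎ ls W a ≡ ℤ.suc u

  ShiftInvariant : Set
  ShiftInvariant = ∀ W → ⟦ park (τ-word W) ⟧ ≐ ⟦ τ-set (park W) ⟧

  -- restrictFrom I? V W selects letters of W only, but they are the last cars of
  -- the word V ++ W: the accumulated prefix V determines where each of them parks.
  restrictFrom : {I : Pred ℤ 0ℓ} → Decidable I → Word → Word → Word
  restrictFrom I? V []      = []
  restrictFrom I? V (a ∷ W) with I? (ls V a)
  ... | yes _ = a ∷ restrictFrom I? (V ∷ʳ a) W
  ... | no  _ = restrictFrom I? (V ∷ʳ a) W

  restrict : {I : Pred ℤ 0ℓ} → Decidable I → Word → Word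
  restrict I? W = restrictFrom I? [] W

  LocallyDecided : Set
  LocallyDecided = ∀ W a t u → IsBlock ⟦ park W ⟧ t u → [ t ⋯ u ] a →
                   ls W a ≡ ls (restrict [ t ⋯ u ]? W) a

  Local : Set
  Local = ShiftInvariant × LocallyDecided

  IsParkingFunction : Pred Word 0ℓ
  IsParkingFunction W = ⟦ park W ⟧ ≐ [ 1ℤ ⋯ + length W ]

{-# OPTIONS --safe #-}

-- Let the last car of a parking function of length n + 1 fill the spot c = i + 1.  Since 𝒫 is
-- bilateral and local and c was free before, the other cars split into a parking function U of
-- {1,…,i} and one, V, of the j = n − i spots above c, which interact only through the way they
-- are shuffled.  The last letter is c, or a letter of {1,…,i} bumped to the right after U, or a
-- letter bumped to the left after V.  A letter of the block is bumped either to the left or to the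
-- right, so for each length n the bumps to the two sides add up to n · p(n), and exchanging i and
-- j in one of the two sums gives p(n + 1) = ∑ (n choose i) (i + 1) p(i) p(j).  The numbers
-- (n + 1)ⁿ⁻¹ satisfy the same recurrence by Abel's identity.
module Submission where

open import Defs
open import Data.Bool.Base using (Bool; true; false)
open import Data.Integer.Base as ℤ using (ℤ; +_; 1ℤ)
import Data.Integer.Properties as ℤ
open import Data.List.Base
  using (List; []; _∷_; _++_; _∷ʳ_; length; map; filter; cartesianProduct; upTo; initLast; _∷ʳ′_)
import Data.List.Membership.DecPropositional as DecMembership
open import Data.List.Membership.Propositional using (_∈_; _∉_)
open import Data.List.Membership.Propositional.Properties
open import Data.List.Properties
  using (++-identityʳ; ∷ʳ-++; ∷ʳ-injective; length-++; length-map; length-upTo;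
         map-++; map-∘; map-id; map-cong; map-injective)
open import Data.List.Relation.Unary.All as All using (All; []; _∷_)
open import Data.List.Relation.Unary.AllPairs using ([]; _∷_)
open import Data.List.Relation.Unary.Any using (here; there)
open import Data.List.Relation.Unary.Unique.Propositional using (Unique)
import Data.List.Relation.Unary.Unique.Propositional.Properties as Unique
open import Data.Nat.Base
  using (ℕ; zero; suc; pred; _+_; _*_; _∸_; _^_; _≤_; _<_; _≥_; z≤n; s≤s)
open import Data.Nat.Induction using (<-rec)
import Data.Nat.Properties as ℕ
open import Data.Nat.Tactic.RingSolver using (solve-∀)
open import Data.Product.Base using (∃-syntax; _×_; _,_; proj₁; proj₂)
open import Data.Sum.Base using (_⊎_; inj₁; inj₂; [_,_]′)
open import Function.Base using (_∘_)
open import Level using (0ℓ)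
open import Relation.Binary.PropositionalEquality
open import Relation.Nullary using (¬_; Dec; yes; no; contradiction)
open import Relation.Nullary.Decidable using (¬?; map′; _×-dec_)
open import Relation.Unary using (Pred; Decidable; _⊆_; _≐_; _∪_; _∩_; ∁; ｛_｝; _⟨×⟩_)

open DecMembership ℤ._≟_ using (_∈?_)
open ≡-Reasoning

-- Abel's identity

-- ∑ₛ f (#true s) (#false s) over all s ∈ {true,false}ⁿ, that is
-- ∑ᵢ₊ⱼ₌ₙ (n choose i) · f i j.
binomialSum : ℕ → (ℕ → ℕ → ℕ) → ℕ
binomialSum zero    f = f 0 0
binomialSum (suc n) f = binomialSum n (λ i j → f (suc i) j) + binomialSum n (λ i j → f i (suc j))

binomialSum-cong : ∀ n {f g} → (∀ i j → i + j ≡ n → f i j ≡ g i j) →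
                   binomialSum n f ≡ binomialSum n g
binomialSum-cong zero    eq = eq 0 0 refl
binomialSum-cong (suc n) eq = cong₂ _+_
  (binomialSum-cong n λ i j i+j≡n → eq (suc i) j (cong suc i+j≡n))
  (binomialSum-cong n λ i j i+j≡n → eq i (suc j) (trans (ℕ.+-suc i j) (cong suc i+j≡n)))

binomialSum-+ : ∀ n f g → binomialSum n (λ i j → f i j + g i j) ≡ binomialSum n f + binomialSum n g
binomialSum-+ zero    f g = refl
binomialSum-+ (suc n) f g = trans
  (cong₂ _+_ (binomialSum-+ n (λ i j → f (suc i) j) (λ i j → g (suc i) j))
             (binomialSum-+ n (λ i j → f i (suc j)) (λ i j → g i (suc j))))
  (interchange (binomialSum n λ i j → f (suc i) j) _ _ _)
  where
  interchange : ∀ a b c d → (a + b) + (c + d) ≡ (a + c) + (b + d)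
  interchange = solve-∀

binomialSum-* : ∀ n k f → binomialSum n (λ i j → k * f i j) ≡ k * binomialSum n f
binomialSum-* zero    k f = refl
binomialSum-* (suc n) k f = trans
  (cong₂ _+_ (binomialSum-* n k λ i j → f (suc i) j) (binomialSum-* n k λ i j → f i (suc j)))
  (sym (ℕ.*-distribˡ-+ k (binomialSum n λ i j → f (suc i) j) _))

binomialSum-swap : ∀ n f → binomialSum n (λ i j → f j i) ≡ binomialSum n f
binomialSum-swap zero    f = refl
binomialSum-swap (suc n) f = trans
  (cong₂ _+_ (binomialSum-swap n λ i j → f i (suc j)) (binomialSum-swap n λ i j → f (suc i) j))
  (ℕ.+-comm (binomialSum n λ i j → f i (suc j)) _)

-- Absorption, j (n + 1 choose j) = (n + 1) (n choose j - 1), obtained from Pascal's rule. The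
-- factor `j` kills the terms in which `pred` is applied to 0.
binomialSum-absorb : ∀ n f → binomialSum (suc n) (λ i j → j * f i (pred j)) ≡
                             suc n * binomialSum n f
binomialSum-absorb zero    f = refl
binomialSum-absorb (suc n) f = begin
  binomialSum (suc n) (λ i j → j * f (suc i) (pred j)) +
    binomialSum (suc n) (λ i j → f i j + j * f i j)
    ≡⟨ cong₂ _+_ (binomialSum-absorb n λ i → f (suc i))
         (trans (binomialSum-+ (suc n) f (λ i j → j * f i j))
           (cong (λ s → binomialSum (suc n) f + s)
             (trans (binomialSum-cong (suc n) step)
                    (binomialSum-absorb n λ i j → f i (suc j))))) ⟩
  suc n * binomialSum n (λ i → f (suc i)) +
    (binomialSum (suc n) f + suc n * binomialSum n (λ i j → f i (suc j)))
    ≡⟨ regroup (suc n) (binomialSum n λ i → f (suc i)) _ ⟩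
  suc (suc n) * binomialSum (suc n) f ∎
  where
  step : ∀ i j → i + j ≡ suc n → j * f i j ≡ j * f i (suc (pred j))
  step i zero    _ = refl
  step i (suc j) _ = refl
  regroup : ∀ m a b → m * a + ((a + b) + m * b) ≡ suc m * (a + b)
  regroup = solve-∀

-- The Abel polynomial y (y + j)^(j - 1), which for j = 0 is 1. At y = 1 it is (j + 1)^(j - 1), the
-- number sought.
abelPoly : ℕ → ℕ → ℕ
abelPoly zero    y = 1
abelPoly (suc j) y = y * (y + suc j) ^ j

abelPoly-* : ∀ j y → (y + j) * abelPoly j y ≡ y * (y + j) ^ j
abelPoly-* zero    y = cong (_* 1) (ℕ.+-identityʳ y)
abelPoly-* (suc j) y = swap (y + suc j) y ((y + suc j) ^ j)
  where
  swap : ∀ a b c → a * (b * c) ≡ b * (a * c)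
  swap = solve-∀

-- `abelSum` is the sum in Abel's identity. `cauchySum` is auxiliary: it does not change when a unit
-- moves between x and y, and this is proved in one induction with Abel's identity.
abelSum cauchySum : ℕ → ℕ → ℕ → ℕ
abelSum   n x y = binomialSum n λ i j → (x + i) ^ i * abelPoly j y
cauchySum n x y = binomialSum n λ i j → (x + i) ^ i * (y + j) ^ j

-- Pascal's rule splits the sum in two. The terms with i + 1 combine with those of the added
-- `cauchySum`, because (x + i + 1) + (y + j) = x + y + n + 1; the terms with j + 1 make up the last
-- sum. Adding on the left instead of subtracting on the right keeps everything in ℕ.
abelSum-suc : ∀ n x y →
  abelSum (suc n) x y + y * cauchySum n (suc x) y ≡
  (x + y + suc n) * abelSum n (suc x) y + y * cauchySum n x (suc y)
abelSum-suc n x y = begin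
  (first + second) + y * cauchySum n (suc x) y
    ≡⟨ regroup first second _ ⟩
  (first + y * cauchySum n (suc x) y) + second
    ≡⟨ cong₂ _+_ first-eq second-eq ⟩
  (x + y + suc n) * abelSum n (suc x) y + y * cauchySum n x (suc y) ∎
  where
  first second : ℕ
  first  = binomialSum n λ i j → (x + suc i) ^ suc i * abelPoly j y
  second = binomialSum n λ i j → (x + i) ^ i * (y * (y + suc j) ^ j)

  regroup : ∀ a b c → (a + b) + c ≡ (a + c) + b
  regroup = solve-∀

  swap : ∀ a b c → a * (b * c) ≡ b * (a * c)
  swap = solve-∀

  second-eq : second ≡ y * cauchySum n x (suc y)
  second-eq = trans
    (binomialSum-cong n λ i j _ → trans (swap ((x + i) ^ i) y _)
      (cong (λ z → y * ((x + i) ^ i * z ^ j)) (ℕ.+-suc y j)))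
    (binomialSum-* n y _)

  term : ∀ i j → i + j ≡ n →
    (x + suc i) ^ suc i * abelPoly j y + y * ((suc x + i) ^ i * (y + j) ^ j) ≡
    (x + y + suc n) * ((suc x + i) ^ i * abelPoly j y)
  term i j refl rewrite ℕ.+-suc x i = begin
    X * Xⁱ * aⱼ + y * (Xⁱ * (y + j) ^ j)
      ≡⟨ cong (λ s → X * Xⁱ * aⱼ + s) (trans (swap y Xⁱ _) (cong (Xⁱ *_) (sym (abelPoly-* j y)))) ⟩
    X * Xⁱ * aⱼ + Xⁱ * ((y + j) * aⱼ)
      ≡⟨ collect x i y j Xⁱ aⱼ ⟩
    (x + y + suc (i + j)) * (Xⁱ * aⱼ) ∎
    where
    X Xⁱ aⱼ : ℕ
    X  = suc (x + i)
    Xⁱ = X ^ i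
    aⱼ = abelPoly j y
    collect : ∀ x i y j p a → suc (x + i) * p * a + p * ((y + j) * a) ≡
                              (x + y + suc (i + j)) * (p * a)
    collect = solve-∀

  first-eq : first + y * cauchySum n (suc x) y ≡ (x + y + suc n) * abelSum n (suc x) y
  first-eq = trans (cong (λ s → first + s) (sym (binomialSum-* n y _)))
    (trans (sym (binomialSum-+ n _ _))
      (trans (binomialSum-cong n term) (binomialSum-* n (x + y + suc n) _)))

-- For j ≥ 1, (y + j)^j = y (y + j)^(j - 1) + j (y + j)^(j - 1). The first summand gives `abelSum`;
-- in the second the factor j is absorbed.
cauchySum-suc : ∀ n x y →
  cauchySum (suc n) x y ≡ abelSum (suc n) x y + suc n * cauchySum n x (suc y)
cauchySum-suc n x y = trans
  (binomialSum-cong (suc n) term)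
  (trans (binomialSum-+ (suc n) (λ i j → (x + i) ^ i * abelPoly j y) λ i j → j * h i (pred j))
    (cong (λ s → abelSum (suc n) x y + s) (binomialSum-absorb n h)))
  where
  h : ℕ → ℕ → ℕ
  h i j = (x + i) ^ i * (suc y + j) ^ j
  expand : ∀ p y j q → p * ((y + suc j) * q) ≡ p * (y * q) + suc j * (p * q)
  expand = solve-∀
  term : ∀ i j → i + j ≡ suc n → (x + i) ^ i * (y + j) ^ j ≡
    (x + i) ^ i * abelPoly j y + j * h i (pred j)
  term i zero    _ = sym (ℕ.+-identityʳ _)
  term i (suc j) _ = trans (expand ((x + i) ^ i) y j _)
    (cong (λ z → (x + i) ^ i * (y * (y + suc j) ^ j) + suc j * ((x + i) ^ i * z ^ j)) (ℕ.+-suc y j))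

mutual
  -- The two `cauchySum` terms of `abelSum-suc` agree by `cauchySum-shift` and cancel, which leaves
  -- x + y + n + 1 times the previous power.
  abel-identity : ∀ n x y → abelSum n x y ≡ (x + y + n) ^ n
  abel-identity zero    x y = refl
  abel-identity (suc n) x y = ℕ.+-cancelʳ-≡ (y * cauchySum n (suc x) y) _ _ (begin
    abelSum (suc n) x y + y * cauchySum n (suc x) y
      ≡⟨ abelSum-suc n x y ⟩
    (x + y + suc n) * abelSum n (suc x) y + y * cauchySum n x (suc y)
      ≡⟨ cong₂ (λ u v → (x + y + suc n) * u + y * v)
           (trans (abel-identity n (suc x) y) (cong (_^ n) (sym (ℕ.+-suc (x + y) n))))
           (cauchySum-shift n x y) ⟩
    (x + y + suc n) ^ suc n + y * cauchySum n (suc x) y ∎)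

  -- Both terms of `cauchySum-suc` survive moving a unit from y to x: the first by Abel's identity,
  -- whose right-hand side involves only x + y, the second by induction.
  cauchySum-shift : ∀ n x y → cauchySum n x (suc y) ≡ cauchySum n (suc x) y
  cauchySum-shift zero    x y = refl
  cauchySum-shift (suc n) x y = begin
    cauchySum (suc n) x (suc y)
      ≡⟨ cauchySum-suc n x (suc y) ⟩
    abelSum (suc n) x (suc y) + suc n * cauchySum n x (suc (suc y))
      ≡⟨ cong₂ (λ u v → u + suc n * v)
           (trans (abel-identity (suc n) x (suc y))
             (trans (cong (λ z → (z + suc n) ^ suc n) (ℕ.+-suc x y))
               (sym (abel-identity (suc n) (suc x) y))))
           (cauchySum-shift n x (suc y)) ⟩
    abelSum (suc n) (suc x) y + suc n * cauchySum n (suc x) (suc y)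
      ≡⟨ sym (cauchySum-suc n (suc x) y) ⟩
    cauchySum (suc n) (suc x) y ∎

-- Finite cardinalities

private variable
  A B : Set
  P Q : Pred A 0ℓ
  m n : ℕ

∉⇒All≢ : ∀ {x : A} {xs} → x ∉ xs → All (x ≢_) xs
∉⇒All≢ x∉xs = All.tabulate λ { y∈xs refl → x∉xs y∈xs }

card-unique : HasCardinality P m → HasCardinality P n → m ≡ n
card-unique (S , (S⊆P , P⊆S) , refl) (T , (T⊆P , P⊆T) , refl) = ℕ.≤-antisym
  (unique-⊆⇒length-≤ (unique S) (P⊆T ∘ S⊆P))
  (unique-⊆⇒length-≤ (unique T) (P⊆S ∘ T⊆P))

card-resp-≐ : P ≐ Q → HasCardinality P n → HasCardinality Q n
card-resp-≐ (P⊆Q , Q⊆P) (S , (S⊆P , P⊆S) , eq) = S , (P⊆Q ∘ S⊆P , P⊆S ∘ Q⊆P) , eq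

module _ (F : A → B → Set) (F-injective : ∀ {a a′ b} → F a b → F a′ b → a ≡ a′) where

  unique-image : ∀ {xs} → Unique xs → (∀ {x} → x ∈ xs → ∃[ y ] F x y) →
    ∃[ ys ] Unique ys × length ys ≡ length xs ×
      (∀ {y} → y ∈ ys → ∃[ x ] x ∈ xs × F x y) ×
      (∀ {x} → x ∈ xs → ∃[ y ] y ∈ ys × F x y)
  unique-image [] _ = [] , [] , refl , (λ ()) , (λ ())
  unique-image {x ∷ xs} (x∉xs ∷ xs!) total
    with total (here refl) | unique-image xs! (total ∘ there)
  ... | y , Fxy | ys , ys! , eq , to , from =
    y ∷ ys , ∉⇒All≢ y∉ys ∷ ys! , cong suc eq , to′ , from′
    where
    y∉ys : y ∉ ys
    y∉ys y∈ys with to y∈ys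
    ... | x′ , x′∈xs , Fx′y = All.lookup x∉xs x′∈xs (F-injective Fxy Fx′y)
    to′ : ∀ {z} → z ∈ y ∷ ys → ∃[ w ] w ∈ x ∷ xs × F w z
    to′ (here refl) = x , here refl , Fxy
    to′ (there z∈)  = let w , w∈ , Fwz = to z∈ in w , there w∈ , Fwz
    from′ : ∀ {w} → w ∈ x ∷ xs → ∃[ z ] z ∈ y ∷ ys × F w z
    from′ (here refl) = y , here refl , Fxy
    from′ (there w∈)  = let z , z∈ , Fwz = from w∈ in z , there z∈ , Fwz

  -- The bijection is a relation rather than a function, because the shuffle of two parking
  -- functions exists only under hypotheses and is obtained from an existence proof.
  card-transport : (∀ {a b b′} → F a b → F a b′ → b ≡ b′) →
    (∀ {a} → P a → ∃[ b ] Q b × F a b) → (∀ {b} → Q b → ∃[ a ] P a × F a b) →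
    HasCardinality P n → HasCardinality Q n
  card-transport {Q = Q} F-functional P⇒Q Q⇒P (S , (S⊆P , P⊆S) , refl)
    with unique-image (unique S) (λ x∈S → let b , _ , Fxb = P⇒Q (S⊆P x∈S) in b , Fxb)
  ... | ys , ys! , eq , to , from =
    record { elements = ys ; unique = ys! } , (ys⊆Q , Q⊆ys) , eq
    where
    ys⊆Q : ∀ {y} → y ∈ ys → Q y
    ys⊆Q y∈ys with to y∈ys
    ... | x , x∈S , Fxy with P⇒Q (S⊆P x∈S)
    ...   | b , Qb , Fxb = subst Q (F-functional Fxb Fxy) Qb
    Q⊆ys : ∀ {y} → Q y → y ∈ ys
    Q⊆ys Qy with Q⇒P Qy
    ... | x , Px , Fxy with from (P⊆S Px)
    ...   | z , z∈ys , Fxz = subst (_∈ ys) (F-functional Fxz Fxy) z∈ys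

card-image : (f : A → B) → (∀ {a a′} → f a ≡ f a′ → a ≡ a′) →
  (∀ {a} → P a → Q (f a)) → (∀ {b} → Q b → ∃[ a ] P a × f a ≡ b) →
  HasCardinality P n → HasCardinality Q n
card-image f f-injective P⇒Q Q⇒P = card-transport (λ a b → f a ≡ b)
  (λ p q → f-injective (trans p (sym q))) (λ p q → trans (sym p) q)
  (λ {a} Pa → f a , P⇒Q Pa , refl) Q⇒P

length-cartesianProduct : ∀ (xs : List A) (ys : List B) →
  length (cartesianProduct xs ys) ≡ length xs * length ys
length-cartesianProduct []       ys = refl
length-cartesianProduct (x ∷ xs) ys = trans (length-++ (map (x ,_) ys))
  (cong₂ _+_ (length-map (x ,_) ys) (length-cartesianProduct xs ys))

card-× : HasCardinality P m → HasCardinality Q n → HasCardinality (P ⟨×⟩ Q) (m * n)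
card-× (S , (S⊆P , P⊆S) , refl) (T , (T⊆Q , Q⊆T) , refl) =
  record { elements = cartesianProduct (elements S) (elements T)
         ; unique   = Unique.cartesianProduct⁺ (unique S) (unique T) } ,
  ((λ xy∈ → let x∈ , y∈ = ∈-cartesianProduct⁻ (elements S) (elements T) xy∈ in S⊆P x∈ , T⊆Q y∈) ,
   (λ (Px , Qy) → ∈-cartesianProduct⁺ (P⊆S Px) (Q⊆T Qy))) ,
  length-cartesianProduct (elements S) (elements T)

card-∪ : HasCardinality P m → HasCardinality Q n → (∀ {x} → P x → ¬ Q x) →
         HasCardinality (P ∪ Q) (m + n)
card-∪ (S , (S⊆P , P⊆S) , refl) (T , (T⊆Q , Q⊆T) , refl) disjoint =
  record { elements = elements S ++ elements T
         ; unique   = Unique.++⁺ (unique S) (unique T)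
                        (λ (x∈S , x∈T) → disjoint (S⊆P x∈S) (T⊆Q x∈T)) } ,
  ((λ x∈ → [ inj₁ ∘ S⊆P , inj₂ ∘ T⊆Q ]′ (∈-++⁻ (elements S) x∈)) ,
   [ ∈-++⁺ˡ ∘ P⊆S , ∈-++⁺ʳ (elements S) ∘ Q⊆T ]′) ,
  length-++ (elements S)

card-filter : Decidable Q → HasCardinality P n → ∃[ k ] HasCardinality (P ∩ Q) k
card-filter Q? (S , (S⊆P , P⊆S) , _) = _ ,
  record { elements = filter Q? (elements S) ; unique = Unique.filter⁺ Q? (unique S) } ,
  ((λ x∈ → let x∈S , Qx = ∈-filter⁻ Q? x∈ in S⊆P x∈S , Qx) ,
   (λ (Px , Qx) → ∈-filter⁺ Q? (P⊆S Px) Qx)) ,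
  refl

card-split : Decidable Q → HasCardinality P n → ∃[ k ] ∃[ l ]
  k + l ≡ n × HasCardinality (P ∩ Q) k × HasCardinality (P ∩ ∁ Q) l
card-split {Q = Q} Q? cP with card-filter Q? cP | card-filter (¬? ∘ Q?) cP
... | k , cQ | l , c¬Q = k , l ,
  card-unique
    (card-resp-≐ ([ proj₁ , proj₁ ]′ , split) (card-∪ cQ c¬Q λ (_ , q) (_ , ¬q) → ¬q q)) cP ,
  cQ , c¬Q
  where
  split : ∀ {x} → _ → _
  split {x} Px with Q? x
  ... | yes q = inj₁ (Px , q)
  ... | no ¬q = inj₂ (Px , ¬q)

card-singleton : ∀ {x : A} → P x → (∀ {y} → P y → y ≡ x) → HasCardinality P 1
card-singleton {x = x} Px only =
  record { elements = x ∷ [] ; unique = [] ∷ [] } , ((λ { (here refl) → Px }) , here ∘ only) , refl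

-- Given by the spot before it and its size, so that size 0 is the empty set and a shift only raises
-- `k`.
interval : ℕ → ℕ → Pred ℤ 0ℓ
interval k n = [ + suc k ⋯ + (k + n) ]

card-interval : ∀ k n → HasCardinality (interval k n) n
card-interval k n = card-image (λ i → + suc (k + i)) f-injective to from
  (record { elements = upTo n ; unique = Unique.upTo⁺ n } , (∈-upTo⁻ , ∈-upTo⁺) , length-upTo n)
  where
  f-injective : ∀ {i j} → + suc (k + i) ≡ + suc (k + j) → i ≡ j
  f-injective eq = ℕ.+-cancelˡ-≡ k _ _ (ℕ.suc-injective (ℤ.+-injective eq))
  to : ∀ {i} → i < n → interval k n (+ suc (k + i))
  to {i} i<n = ℤ.+≤+ (s≤s (ℕ.m≤m+n k i)) ,
    ℤ.+≤+ (ℕ.≤-trans (ℕ.≤-reflexive (sym (ℕ.+-suc k i))) (ℕ.+-monoʳ-≤ k i<n))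
  from : ∀ {x} → interval k n x → ∃[ i ] i < n × + suc (k + i) ≡ x
  from (ℤ.+≤+ {n = suc x} (s≤s k≤x) , ℤ.+≤+ x<k+n) = x ∸ k ,
    ℕ.+-cancelˡ-< k _ _ (subst (_< k + n) (sym k+[x∸k]≡x) x<k+n) ,
    cong (+_ ∘ suc) k+[x∸k]≡x
    where
    k+[x∸k]≡x : k + (x ∸ k) ≡ x
    k+[x∸k]≡x = ℕ.m+[n∸m]≡n k≤x

#true #false : List Bool → ℕ
#true  []          = 0
#true  (true  ∷ σ) = suc (#true σ)
#true  (false ∷ σ) = #true σ
#false []          = 0
#false (true  ∷ σ) = #false σ
#false (false ∷ σ) = suc (#false σ)

WithSteps : ∀ {X : Set} → ℕ → (ℕ → ℕ → Pred X 0ℓ) → Pred (List Bool × X) 0ℓ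
WithSteps n R (σ , x) = length σ ≡ n × R (#true σ) (#false σ) x

-- The coefficient (n choose i) counts the patterns σ with i entries `true`. Classifying by the
-- first entry matches the recursion of `binomialSum`.
card-binomialSum : ∀ n {X : Set} (R : ℕ → ℕ → Pred X 0ℓ) {f} →
  (∀ i j → HasCardinality (R i j) (f i j)) →
  HasCardinality (WithSteps n R) (binomialSum n f)
card-binomialSum zero R cR = card-image {Q = WithSteps zero R} ([] ,_) (λ { refl → refl })
  (refl ,_) (λ { {[] , x} (_ , r) → x , r , refl }) (cR 0 0)
card-binomialSum (suc n) {X} R cR = card-resp-≐ (to , from) (card-∪
  (card-image {Q = Starts true} (cons true) (λ { refl → refl }) (λ p → _ , refl , p)
    (λ (_ , eq , p) → _ , p , eq) (card-binomialSum n (shifted true) λ i j → cR (suc i) j))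
  (card-image {Q = Starts false} (cons false) (λ { refl → refl }) (λ p → _ , refl , p)
    (λ (_ , eq , p) → _ , p , eq) (card-binomialSum n (shifted false) λ i j → cR i (suc j)))
  λ { (_ , refl , _) (_ , () , _) })
  where
  cons : Bool → List Bool × X → List Bool × X
  cons b (σ , x) = b ∷ σ , x
  shifted : Bool → ℕ → ℕ → Pred X 0ℓ
  shifted true  i j = R (suc i) j
  shifted false i j = R i (suc j)
  Starts : Bool → Pred (List Bool × X) 0ℓ
  Starts b y = ∃[ z ] cons b z ≡ y × WithSteps n (shifted b) z
  to : ∀ {y} → (Starts true ∪ Starts false) y → WithSteps (suc n) R y
  to (inj₁ (_ , refl , eq , r)) = cong suc eq , r
  to (inj₂ (_ , refl , eq , r)) = cong suc eq , r
  from : ∀ {y} → WithSteps (suc n) R y → (Starts true ∪ Starts false) y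
  from {true  ∷ σ , x} (refl , r) = inj₁ (_ , refl , refl , r)
  from {false ∷ σ , x} (refl , r) = inj₂ (_ , refl , refl , r)

card-words : HasCardinality P m → ∀ n → HasCardinality (λ W → length W ≡ n × All P W) (m ^ n)
card-words cP zero    = card-singleton (refl , []) λ { {[]} _ → refl }
card-words cP (suc n) = card-image (λ (x , W) → x ∷ W) (λ { refl → refl })
  (λ { (Px , refl , PW) → refl , Px ∷ PW })
  (λ { {x ∷ W} (refl , Px ∷ PW) → _ , (Px , refl , PW) , refl })
  (card-× cP (card-words cP n))

-- Blocks of a finite set of integers

i<suc[i] : ∀ i → i ℤ.< ℤ.suc i
i<suc[i] i = ℤ.suc[i]≤j⇒i<j ℤ.≤-refl

pred[i]<i : ∀ i → ℤ.pred i ℤ.< i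
pred[i]<i i = ℤ.i≤pred[j]⇒i<j ℤ.≤-refl

i<suc[j]⇒i≤j : ∀ {i j} → i ℤ.< ℤ.suc j → i ℤ.≤ j
i<suc[j]⇒i≤j {i} {j} i<1+j = subst (i ℤ.≤_) (ℤ.pred-suc j) (ℤ.i<j⇒i≤pred[j] i<1+j)

+-+suc : ∀ i n → i ℤ.+ + suc n ≡ ℤ.suc (i ℤ.+ + n)
+-+suc i n = trans (sym (ℤ.+-assoc i 1ℤ (+ n)))
  (trans (cong (ℤ._+ + n) (ℤ.+-comm i 1ℤ)) (ℤ.+-assoc 1ℤ i (+ n)))

suc-+ : ∀ i n → ℤ.suc i ℤ.+ + n ≡ ℤ.suc (i ℤ.+ + n)
suc-+ i n = ℤ.+-assoc 1ℤ i (+ n)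

-- A block described by its two free neighbours instead of by maximality. This form is easy to
-- transfer from one set to another.
record Run (S : Pred ℤ 0ℓ) (t u : ℤ) : Set where
  field
    nonempty  : t ℤ.≤ u
    contained : [ t ⋯ u ] ⊆ S
    gap-left  : ¬ S (ℤ.pred t)
    gap-right : ¬ S (ℤ.suc u)

  -- A larger interval reaching beyond `t` or `u` would contain `pred t` or `suc u`.
  isBlock : IsBlock S t u
  isBlock .IsBlock.nonempty  = nonempty
  isBlock .IsBlock.contained = contained
  isBlock .IsBlock.maximal {t′} {u′} sub sup {x} (t′≤x , x≤u′) = t≤x , x≤u
    where
    t≤x : t ℤ.≤ x
    t≤x = ℤ.≮⇒≥ λ x<t → gap-left (sup
      ( ℤ.≤-trans t′≤x (ℤ.i<j⇒i≤pred[j] x<t)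
      , ℤ.≤-trans (ℤ.<⇒≤ (pred[i]<i t)) (proj₂ (sub (ℤ.≤-refl , nonempty)))))
    x≤u : x ℤ.≤ u
    x≤u = ℤ.≮⇒≥ λ u<x → gap-right (sup
      ( ℤ.≤-trans (proj₁ (sub (nonempty , ℤ.≤-refl))) (ℤ.i≤suc[i] u)
      , ℤ.≤-trans (ℤ.i<j⇒suc[i]≤j u<x) x≤u′))

-- The fuel n bounds the distance from a to the elements of S on the side searched.
run-right : ∀ {S : Pred ℤ 0ℓ} → Decidable S → ∀ n {a} → (∀ {x} → S x → x ℤ.< a ℤ.+ + n) → S a →
            ∃[ u ] a ℤ.≤ u × [ a ⋯ u ] ⊆ S × ¬ S (ℤ.suc u)
run-right S? zero {a} bound Sa =
  contradiction (subst (a ℤ.<_) (ℤ.+-identityʳ a) (bound Sa)) (ℤ.<-irrefl refl)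
run-right {S} S? (suc n) {a} bound Sa with S? (ℤ.suc a)
... | no ¬S1+a = a , ℤ.≤-refl ,
  (λ (a≤x , x≤a) → subst S (ℤ.≤-antisym a≤x x≤a) Sa) , ¬S1+a
... | yes S1+a with run-right S? n
        (λ {x} Sx → subst (x ℤ.<_) (trans (+-+suc a n) (sym (suc-+ a n))) (bound Sx)) S1+a
...   | u , 1+a≤u , sub , gap = u , ℤ.≤-trans (ℤ.i≤suc[i] a) 1+a≤u , sub′ , gap
  where
  sub′ : [ a ⋯ u ] ⊆ S
  sub′ {x} (a≤x , x≤u) with a ℤ.≟ x
  ... | yes refl = Sa
  ... | no a≢x   = sub (ℤ.i<j⇒suc[i]≤j (ℤ.≤∧≢⇒< a≤x a≢x) , x≤u)

run-left : ∀ {S : Pred ℤ 0ℓ} → Decidable S → ∀ n {a} → (∀ {x} → S x → a ℤ.< x ℤ.+ + n) → S a →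
           ∃[ t ] t ℤ.≤ a × [ t ⋯ a ] ⊆ S × ¬ S (ℤ.pred t)
run-left S? zero {a} bound Sa =
  contradiction (subst (a ℤ.<_) (ℤ.+-identityʳ a) (bound Sa)) (ℤ.<-irrefl refl)
run-left {S} S? (suc n) {a} bound Sa with S? (ℤ.pred a)
... | no ¬Sa-1 = a , ℤ.≤-refl ,
  (λ (a≤x , x≤a) → subst S (ℤ.≤-antisym a≤x x≤a) Sa) , ¬Sa-1
... | yes Sa-1 with run-left S? n
        (λ {x} Sx → ℤ.<-≤-trans (pred[i]<i a)
          (i<suc[j]⇒i≤j (subst (a ℤ.<_) (+-+suc x n) (bound Sx)))) Sa-1
...   | t , t≤a-1 , sub , gap = t , ℤ.≤-trans t≤a-1 (ℤ.<⇒≤ (pred[i]<i a)) , sub′ , gap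
  where
  sub′ : [ t ⋯ a ] ⊆ S
  sub′ {x} (t≤x , x≤a) with x ℤ.≟ a
  ... | yes refl = Sa
  ... | no x≢a   = sub (t≤x , ℤ.i<j⇒i≤pred[j] (ℤ.≤∧≢⇒< x≤a x≢a))

i+[j-i]≡j : ∀ i j → i ℤ.+ (j ℤ.- i) ≡ j
i+[j-i]≡j i j = trans (ℤ.+-comm i (j ℤ.- i)) (trans (ℤ.+-assoc j (ℤ.- i) i)
  (trans (cong (λ k → j ℤ.+ k) (ℤ.+-inverseˡ i)) (ℤ.+-identityʳ j)))

i≤+∣i∣ : ∀ i → i ℤ.≤ + ℤ.∣ i ∣
i≤+∣i∣ (+ _)       = ℤ.≤-refl
i≤+∣i∣ ℤ.-[1+ _ ] = ℤ.-≤+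

distance-bound : ∀ i j → i ℤ.< j ℤ.+ + suc ℤ.∣ i ℤ.- j ∣
distance-bound i j = subst (i ℤ.<_) (sym (+-+suc j _)) (ℤ.≤-<-trans
  (subst (ℤ._≤ j ℤ.+ + ℤ.∣ i ℤ.- j ∣) (i+[j-i]≡j j i) (ℤ.+-monoʳ-≤ j (i≤+∣i∣ (i ℤ.- j))))
  (i<suc[i] _))

-- A single `n` serves as fuel for the searches in both directions.
bounded : ∀ a xs → ∃[ n ] ∀ {x} → x ∈ xs → x ℤ.< a ℤ.+ + n × a ℤ.< x ℤ.+ + n
bounded a []       = 0 , λ ()
bounded a (y ∷ ys) with bounded a ys
... | n , bound = k + n , bound′
  where
  k : ℕ
  k = suc ℤ.∣ y ℤ.- a ∣
  weaken : ∀ {i} j {m} → m ≤ k + n → i ℤ.< j ℤ.+ + m → i ℤ.< j ℤ.+ + (k + n)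
  weaken j m≤ i< = ℤ.<-≤-trans i< (ℤ.+-monoʳ-≤ j (ℤ.+≤+ m≤))
  bound′ : ∀ {x} → x ∈ y ∷ ys → x ℤ.< a ℤ.+ + (k + n) × a ℤ.< x ℤ.+ + (k + n)
  bound′ (here refl) = weaken a (ℕ.m≤m+n k n) (distance-bound y a) ,
    weaken y (ℕ.m≤m+n k n)
      (subst (λ d → a ℤ.< y ℤ.+ + suc d) (ℤ.∣i-j∣≡∣j-i∣ a y) (distance-bound a y))
  bound′ {x} (there x∈ys) = let x< , a< = bound x∈ys in
    weaken a (ℕ.m≤n+m n k) x< , weaken x (ℕ.m≤n+m n k) a<

run-exists : ∀ {a xs} → a ∈ xs → ∃[ t ] ∃[ u ] Run (_∈ xs) t u × [ t ⋯ u ] a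
run-exists {a} {xs} a∈xs with bounded a xs
... | n , bound
  with run-right (_∈? xs) n (proj₁ ∘ bound) a∈xs | run-left (_∈? xs) n (proj₂ ∘ bound) a∈xs
... | u , a≤u , subʳ , gapʳ | t , t≤a , subˡ , gapˡ = t , u , record
  { nonempty = ℤ.≤-trans t≤a a≤u ; contained = sub ; gap-left = gapˡ ; gap-right = gapʳ } ,
  (t≤a , a≤u)
  where
  sub : [ t ⋯ u ] ⊆ (_∈ xs)
  sub {x} (t≤x , x≤u) with ℤ.≤-total x a
  ... | inj₁ x≤a = subˡ (t≤x , x≤a)
  ... | inj₂ a≤x = subʳ (a≤x , x≤u)

-- The spot of the last car, and restricted words

module Parking (𝒫 : ParkingProcedure) where
  open ParkingProcedure 𝒫

  ls-parked : ∀ W a → ⟦ park (W ∷ʳ a) ⟧ (ls 𝒫 W a)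
  ls-parked W a = proj₁ (proj₁ (proj₂ (ls-∃! 𝒫 W a)))

  ls-free : ∀ W a → ¬ ⟦ park W ⟧ (ls 𝒫 W a)
  ls-free W a = proj₂ (proj₁ (proj₂ (ls-∃! 𝒫 W a)))

  ls-unique : ∀ W a {x} → ⟦ park (W ∷ʳ a) ⟧ x → ¬ ⟦ park W ⟧ x → ls 𝒫 W a ≡ x
  ls-unique W a x∈ x∉ = proj₂ (proj₂ (ls-∃! 𝒫 W a)) (x∈ , x∉)

  park-∷ʳ : ∀ W a → ⟦ park (W ∷ʳ a) ⟧ ≐ ⟦ park W ⟧ ∪ ｛ ls 𝒫 W a ｝
  park-∷ʳ W a = to , from
    where
    to : ⟦ park (W ∷ʳ a) ⟧ ⊆ ⟦ park W ⟧ ∪ ｛ ls 𝒫 W a ｝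
    to {x} x∈ with x ∈? elements (park W)
    ... | yes x∈W = inj₁ x∈W
    ... | no x∉W  = inj₂ (ls-unique W a x∈ x∉W)
    from : ⟦ park W ⟧ ∪ ｛ ls 𝒫 W a ｝ ⊆ ⟦ park (W ∷ʳ a) ⟧
    from (inj₁ x∈W)  = monotone W a x∈W
    from (inj₂ refl) = ls-parked W a

  ls-lucky : ∀ W a → ¬ ⟦ park W ⟧ a → ls 𝒫 W a ≡ a
  ls-lucky W a a∉W = ls-unique W a (proj₂ (lucky W a a∉W) (inj₂ refl)) a∉W

  park-++ : ∀ W W′ → ⟦ park W ⟧ ⊆ ⟦ park (W ++ W′) ⟧
  park-++ W []       x∈ = subst (λ V → ⟦ park V ⟧ _) (sym (++-identityʳ W)) x∈
  park-++ W (a ∷ W′) x∈ =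
    subst (λ V → ⟦ park V ⟧ _) (∷ʳ-++ W a W′) (park-++ (W ∷ʳ a) W′ (monotone W a x∈))

  ls-parked-++ : ∀ W a W′ → ⟦ park (W ++ a ∷ W′) ⟧ (ls 𝒫 W a)
  ls-parked-++ W a W′ =
    subst (λ V → ⟦ park V ⟧ _) (∷ʳ-++ W a W′) (park-++ (W ∷ʳ a) W′ (ls-parked W a))

  module _ {I : Pred ℤ 0ℓ} (I? : Decidable I) where

    -- `restrictFrom` reads its word from the left, whereas cars arrive on the right. This lemma and
    -- the next give its recursion at the right end.
    restrictFrom-∷ʳ-∈ : ∀ V W a → I (ls 𝒫 (V ++ W) a) →
      restrictFrom 𝒫 I? V (W ∷ʳ a) ≡ restrictFrom 𝒫 I? V W ∷ʳ a
    restrictFrom-∷ʳ-∈ V [] a s∈I with I? (ls 𝒫 V a)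
    ... | yes _  = refl
    ... | no s∉I = contradiction (subst (λ V → I (ls 𝒫 V a)) (++-identityʳ V) s∈I) s∉I
    restrictFrom-∷ʳ-∈ V (b ∷ W) a s∈I
      with I? (ls 𝒫 V b)
         | restrictFrom-∷ʳ-∈ (V ∷ʳ b) W a (subst (λ V → I (ls 𝒫 V a)) (sym (∷ʳ-++ V b W)) s∈I)
    ... | yes _ | eq = cong (b ∷_) eq
    ... | no _  | eq = eq

    restrictFrom-∷ʳ-∉ : ∀ V W a → ¬ I (ls 𝒫 (V ++ W) a) →
      restrictFrom 𝒫 I? V (W ∷ʳ a) ≡ restrictFrom 𝒫 I? V W
    restrictFrom-∷ʳ-∉ V [] a s∉I with I? (ls 𝒫 V a)
    ... | yes s∈I = contradiction (subst (λ V → I (ls 𝒫 V a)) (sym (++-identityʳ V)) s∈I) s∉I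
    ... | no _    = refl
    restrictFrom-∷ʳ-∉ V (b ∷ W) a s∉I
      with I? (ls 𝒫 V b)
         | restrictFrom-∷ʳ-∉ (V ∷ʳ b) W a (s∉I ∘ subst (λ V → I (ls 𝒫 V a)) (∷ʳ-++ V b W))
    ... | yes _ | eq = cong (b ∷_) eq
    ... | no _  | eq = eq

-- Separation by a free spot

-- A is one of the two half-lines cut out of ℤ by removing c, and B is the other one.
record HalfLine (c : ℤ) (A B : Pred ℤ 0ℓ) : Set where
  field
    convex    : ∀ {t u} → A t → A u → [ t ⋯ u ] ⊆ A
    near-pred : ∀ {x} → A x → A (ℤ.pred x) ⊎ ℤ.pred x ≡ c
    near-suc  : ∀ {x} → A x → A (ℤ.suc x) ⊎ ℤ.suc x ≡ c
    avoids    : ¬ A c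
    disjoint  : ∀ {x} → A x → ¬ B x
    total     : ∀ {x} → x ≢ c → A x ⊎ B x

below : ∀ c → HalfLine c (ℤ._< c) (c ℤ.<_)
below c = record
  { convex    = λ _ u<c (_ , x≤u) → ℤ.≤-<-trans x≤u u<c
  ; near-pred = λ {x} x<c → inj₁ (ℤ.<-trans (pred[i]<i x) x<c)
  ; near-suc  = near
  ; avoids    = ℤ.<-irrefl refl
  ; disjoint  = ℤ.<-asym
  ; total     = λ x≢c → [ inj₁ , inj₂ ]′ (split x≢c)
  }
  where
  near : ∀ {x} → x ℤ.< c → ℤ.suc x ℤ.< c ⊎ ℤ.suc x ≡ c
  near {x} x<c with ℤ.suc x ℤ.≟ c
  ... | yes eq = inj₂ eq
  ... | no neq = inj₁ (ℤ.≤∧≢⇒< (ℤ.i<j⇒suc[i]≤j x<c) neq)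
  split : ∀ {x} → x ≢ c → x ℤ.< c ⊎ c ℤ.< x
  split {x} x≢c with x ℤ.<? c
  ... | yes x<c = inj₁ x<c
  ... | no x≮c  = inj₂ (ℤ.≤∧≢⇒< (ℤ.≮⇒≥ x≮c) (x≢c ∘ sym))

above : ∀ c → HalfLine c (c ℤ.<_) (ℤ._< c)
above c = record
  { convex    = λ c<t _ (t≤x , _) → ℤ.<-≤-trans c<t t≤x
  ; near-pred = near
  ; near-suc  = λ {x} c<x → inj₁ (ℤ.<-trans c<x (i<suc[i] x))
  ; avoids    = ℤ.<-irrefl refl
  ; disjoint  = ℤ.<-asym
  ; total     = λ x≢c → [ inj₂ , inj₁ ]′ (HalfLine.total (below c) x≢c)
  }
  where
  near : ∀ {x} → c ℤ.< x → c ℤ.< ℤ.pred x ⊎ ℤ.pred x ≡ c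
  near {x} c<x with c ℤ.≟ ℤ.pred x
  ... | yes eq = inj₂ (sym eq)
  ... | no neq = inj₁ (ℤ.≤∧≢⇒< (ℤ.i<j⇒i≤pred[j] c<x) neq)

module BilateralLocal (𝒫 : ParkingProcedure) (bilateral : Bilateral 𝒫)
  (locallyDecided : LocallyDecided 𝒫) where
  open ParkingProcedure 𝒫
  open Parking 𝒫

  -- U is the subword of W made of the cars that park in A.
  record Subword (A : Pred ℤ 0ℓ) (W U : Word) : Set where
    field
      park≐     : ⟦ park U ⟧ ≐ ⟦ park W ⟧ ∩ A
      restrict≡ : ∀ t u → [ t ⋯ u ] ⊆ A →
                  restrict 𝒫 [ t ⋯ u ]? W ≡ restrict 𝒫 [ t ⋯ u ]? U
  open Subword

  -- The invariant maintained while cars arrive. Both half-lines are parameters, so that each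
  -- argument is made for one side and `Parts-swap` yields the other.
  record Parts (c : ℤ) (A B : Pred ℤ 0ℓ) (W U V : Word) : Set where
    field
      c∉W : ¬ ⟦ park W ⟧ c
      U⊑W : Subword A W U
      V⊑W : Subword B W V

  Parts-swap : ∀ {c A B W U V} → Parts c A B W U V → Parts c B A W V U
  Parts-swap parts = record { c∉W = c∉W ; U⊑W = V⊑W ; V⊑W = U⊑W }
    where open Parts parts

  Parts-[] : ∀ {c A B} → Parts c A B [] [] []
  Parts-[] = record { c∉W = proj₁ park-ε ; U⊑W = empty ; V⊑W = empty }
    where
    empty : ∀ {A} → Subword A [] []
    empty = record
      { park≐     = (λ x∈ → contradiction x∈ (proj₁ park-ε)) , proj₁
      ; restrict≡ = λ _ _ _ → refl
      }

  -- The block of `park U` around `a` is also a block of `park W`: its neighbours lie in `A` or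
  -- equal `c`, and `c` is free. Local decision then sees the same restricted word in both cases,
  -- and bilaterality sends the car to one of those neighbours.
  ls-Subword : ∀ {c A B W U a} → HalfLine c A B → ¬ ⟦ park W ⟧ c → Subword A W U →
               ⟦ park U ⟧ a → ls 𝒫 W a ≡ ls 𝒫 U a × (A (ls 𝒫 U a) ⊎ ls 𝒫 U a ≡ c)
  ls-Subword {c} {A} {B} {W} {U} {a} half c∉W U⊑W a∈U with run-exists a∈U
  ... | t , u , run , a∈I = same , near (bilateral U a t u isBlock a∈I)
    where
    open HalfLine half
    open Run run
    At : A t
    At = proj₂ (proj₁ (park≐ U⊑W) (contained (ℤ.≤-refl , nonempty)))
    Au : A u
    Au = proj₂ (proj₁ (park≐ U⊑W) (contained (nonempty , ℤ.≤-refl)))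
    gap : ∀ {x} → ¬ ⟦ park U ⟧ x → A x ⊎ x ≡ c → ¬ ⟦ park W ⟧ x
    gap x∉U (inj₁ Ax)   x∈W = x∉U (proj₂ (park≐ U⊑W) (x∈W , Ax))
    gap x∉U (inj₂ refl) x∈W = c∉W x∈W
    runW : Run ⟦ park W ⟧ t u
    runW = record
      { nonempty  = nonempty
      ; contained = proj₁ ∘ proj₁ (park≐ U⊑W) ∘ contained
      ; gap-left  = gap gap-left (near-pred At)
      ; gap-right = gap gap-right (near-suc Au)
      }
    same : ls 𝒫 W a ≡ ls 𝒫 U a
    same = trans (locallyDecided W a t u (Run.isBlock runW) a∈I)
      (trans (cong (λ V → ls 𝒫 V a) (restrict≡ U⊑W t u (convex At Au)))
             (sym (locallyDecided U a t u isBlock a∈I)))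
    near : ls 𝒫 U a ≡ ℤ.pred t ⊎ ls 𝒫 U a ≡ ℤ.suc u → A (ls 𝒫 U a) ⊎ ls 𝒫 U a ≡ c
    near (inj₁ eq) rewrite eq = near-pred At
    near (inj₂ eq) rewrite eq = near-suc Au

  module _ {c : ℤ} {A B : Pred ℤ 0ℓ} (halfA : HalfLine c A B) (halfB : HalfLine c B A)
    {W U V : Word} (parts : Parts c A B W U V) (a : ℤ) where
    open HalfLine halfA
    open Parts parts

    -- Here only the behaviour of the part is known, as when a shuffle is being built. A preference
    -- free in `U` is then the spot taken, which lies in `A`, so it is free in `W` too.
    ls-whole : A (ls 𝒫 U a) → ls 𝒫 W a ≡ ls 𝒫 U a
    ls-whole As with a ∈? elements (park U)
    ... | yes a∈U = proj₁ (ls-Subword halfA c∉W U⊑W a∈U)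
    ... | no a∉U  = trans (ls-lucky W a a∉W) (sym s≡a)
      where
      s≡a : ls 𝒫 U a ≡ a
      s≡a = ls-lucky U a a∉U
      a∉W : ¬ ⟦ park W ⟧ a
      a∉W a∈W = a∉U (proj₂ (park≐ U⊑W) (a∈W , subst A s≡a As))

    -- A car preferring an occupied spot of `B` parks in `B` or at `c`, never in `A`. So the
    -- preference is either free or an occupied spot of `A`, and `U` decides alike.
    ls-part : A (ls 𝒫 W a) → ls 𝒫 U a ≡ ls 𝒫 W a
    ls-part As with a ∈? elements (park W)
    ... | no a∉W  = trans (ls-lucky U a (a∉W ∘ proj₁ ∘ proj₁ (park≐ U⊑W))) (sym (ls-lucky W a a∉W))
    ... | yes a∈W with total {a} (λ { refl → c∉W a∈W })
    ...   | inj₁ Aa = sym (proj₁ (ls-Subword halfA c∉W U⊑W (proj₂ (park≐ U⊑W) (a∈W , Aa))))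
    ...   | inj₂ Ba with ls-Subword halfB c∉W V⊑W (proj₂ (park≐ V⊑W) (a∈W , Ba))
    ...     | eq , near rewrite eq = contradiction near
      [ disjoint As , (λ s≡c → avoids (subst A s≡c As)) ]′

    Parts-∷ʳ : A (ls 𝒫 W a) → Parts c A B (W ∷ʳ a) (U ∷ʳ a) V
    Parts-∷ʳ As = record
      { c∉W = λ c∈ → [ c∉W , (λ s≡c → avoids (subst A s≡c As)) ]′ (proj₁ (park-∷ʳ W a) c∈)
      ; U⊑W = record { park≐ = toU , fromU ; restrict≡ = restrictU }
      ; V⊑W = record { park≐ = toV , fromV ; restrict≡ = restrictV }
      }
      where
      s≡ : ls 𝒫 U a ≡ ls 𝒫 W a
      s≡ = ls-part As
      toU : ⟦ park (U ∷ʳ a) ⟧ ⊆ ⟦ park (W ∷ʳ a) ⟧ ∩ A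
      toU x∈ with proj₁ (park-∷ʳ U a) x∈
      ... | inj₁ x∈U  = let x∈W , Ax = proj₁ (park≐ U⊑W) x∈U in monotone W a x∈W , Ax
      ... | inj₂ refl rewrite s≡ = ls-parked W a , As
      fromU : ⟦ park (W ∷ʳ a) ⟧ ∩ A ⊆ ⟦ park (U ∷ʳ a) ⟧
      fromU (x∈ , Ax) with proj₁ (park-∷ʳ W a) x∈
      ... | inj₁ x∈W  = monotone U a (proj₂ (park≐ U⊑W) (x∈W , Ax))
      ... | inj₂ refl = subst ⟦ park (U ∷ʳ a) ⟧ s≡ (ls-parked U a)
      toV : ⟦ park V ⟧ ⊆ ⟦ park (W ∷ʳ a) ⟧ ∩ B
      toV x∈V = let x∈W , Bx = proj₁ (park≐ V⊑W) x∈V in monotone W a x∈W , Bx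
      fromV : ⟦ park (W ∷ʳ a) ⟧ ∩ B ⊆ ⟦ park V ⟧
      fromV (x∈ , Bx) with proj₁ (park-∷ʳ W a) x∈
      ... | inj₁ x∈W  = proj₂ (park≐ V⊑W) (x∈W , Bx)
      ... | inj₂ refl = contradiction Bx (disjoint As)
      restrictU : ∀ t u → [ t ⋯ u ] ⊆ A →
        restrict 𝒫 [ t ⋯ u ]? (W ∷ʳ a) ≡ restrict 𝒫 [ t ⋯ u ]? (U ∷ʳ a)
      restrictU t u I⊆A with [ t ⋯ u ]? (ls 𝒫 W a)
      ... | yes s∈I = trans (restrictFrom-∷ʳ-∈ [ t ⋯ u ]? [] W a s∈I)
        (trans (cong (_∷ʳ a) (restrict≡ U⊑W t u I⊆A))
          (sym (restrictFrom-∷ʳ-∈ [ t ⋯ u ]? [] U a (subst [ t ⋯ u ] (sym s≡) s∈I))))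
      ... | no s∉I  = trans (restrictFrom-∷ʳ-∉ [ t ⋯ u ]? [] W a s∉I)
        (trans (restrict≡ U⊑W t u I⊆A)
          (sym (restrictFrom-∷ʳ-∉ [ t ⋯ u ]? [] U a (s∉I ∘ subst [ t ⋯ u ] s≡))))
      restrictV : ∀ t u → [ t ⋯ u ] ⊆ B →
        restrict 𝒫 [ t ⋯ u ]? (W ∷ʳ a) ≡ restrict 𝒫 [ t ⋯ u ]? V
      restrictV t u I⊆B = trans
        (restrictFrom-∷ʳ-∉ [ t ⋯ u ]? [] W a (disjoint As ∘ I⊆B)) (restrict≡ V⊑W t u I⊆B)

  -- The cars of W₂, parking after those of W₁, avoid c; σ records the side on which each of
  -- them parks, and U and V collect the cars parking below and above c.
  data Split (c : ℤ) : (W₁ : Word) (σ : List Bool) (U V W₂ : Word) → Set where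
    []   : ∀ {W} → Split c W [] [] [] []
    low  : ∀ {W₁ σ U V W₂ a} → ls 𝒫 W₁ a ℤ.< c → Split c (W₁ ∷ʳ a) σ U V W₂ →
           Split c W₁ (true ∷ σ) (a ∷ U) V (a ∷ W₂)
    high : ∀ {W₁ σ U V W₂ a} → c ℤ.< ls 𝒫 W₁ a → Split c (W₁ ∷ʳ a) σ U V W₂ →
           Split c W₁ (false ∷ σ) U (a ∷ V) (a ∷ W₂)

  module _ {c : ℤ} where

    Split-functional : ∀ {W₁ σ U V W₂ W₂′} → Split c W₁ σ U V W₂ → Split c W₁ σ U V W₂′ → W₂ ≡ W₂′
    Split-functional []         []         = refl
    Split-functional (low _ s)  (low _ s′)  = cong (_ ∷_) (Split-functional s s′)
    Split-functional (high _ s) (high _ s′) = cong (_ ∷_) (Split-functional s s′)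

    Split-injective : ∀ {W₁ σ σ′ U U′ V V′ W₂} →
      Split c W₁ σ U V W₂ → Split c W₁ σ′ U′ V′ W₂ → σ ≡ σ′ × U ≡ U′ × V ≡ V′
    Split-injective []         []         = refl , refl , refl
    Split-injective (low _ s)  (low _ s′)  with refl , refl , refl ← Split-injective s s′ =
      refl , refl , refl
    Split-injective (high _ s) (high _ s′) with refl , refl , refl ← Split-injective s s′ =
      refl , refl , refl
    Split-injective (low s<c _)  (high c<s _) = contradiction c<s (ℤ.<-asym s<c)
    Split-injective (high c<s _) (low s<c _)  = contradiction c<s (ℤ.<-asym s<c)

    Split-lengths : ∀ {W₁ σ U V W₂} → Split c W₁ σ U V W₂ →
      length σ ≡ length W₂ × #true σ ≡ length U × #false σ ≡ length V
    Split-lengths []         = refl , refl , refl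
    Split-lengths (low _ s)  with p , q , r ← Split-lengths s = cong suc p , cong suc q , r
    Split-lengths (high _ s) with p , q , r ← Split-lengths s = cong suc p , q , cong suc r

    Split-Parts : ∀ {W₁ U₁ V₁ σ U V W₂} → Parts c (ℤ._< c) (c ℤ.<_) W₁ U₁ V₁ →
      Split c W₁ σ U V W₂ → Parts c (ℤ._< c) (c ℤ.<_) (W₁ ++ W₂) (U₁ ++ U) (V₁ ++ V)
    Split-Parts {W₁} {U₁} {V₁} parts []
      rewrite ++-identityʳ W₁ | ++-identityʳ U₁ | ++-identityʳ V₁ = parts
    Split-Parts {W₁} {U₁} parts (low {U = U} {W₂ = W₂} {a = a} s<c s)
      with Split-Parts (Parts-∷ʳ (below c) (above c) parts a s<c) s
    ... | parts′ rewrite ∷ʳ-++ W₁ a W₂ | ∷ʳ-++ U₁ a U = parts′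
    Split-Parts {W₁} {V₁ = V₁} parts (high {V = V} {W₂ = W₂} {a = a} c<s s)
      with Split-Parts (Parts-swap (Parts-∷ʳ (above c) (below c) (Parts-swap parts) a c<s)) s
    ... | parts′ rewrite ∷ʳ-++ W₁ a W₂ | ∷ʳ-++ V₁ a V = parts′

    -- Occupied spots stay occupied, so a spot free at the end was taken by no car, and each car
    -- parked strictly on one side of it.
    split : ∀ W₁ W₂ → ¬ ⟦ park (W₁ ++ W₂) ⟧ c → ∃[ σ ] ∃[ U ] ∃[ V ] Split c W₁ σ U V W₂
    split W₁ []       _   = _ , _ , _ , []
    split W₁ (a ∷ W₂) c∉
      with split (W₁ ∷ʳ a) W₂ (c∉ ∘ subst (λ W → ⟦ park W ⟧ c) (∷ʳ-++ W₁ a W₂))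
         | HalfLine.total (below c) {ls 𝒫 W₁ a} (λ { refl → c∉ (ls-parked-++ W₁ a W₂) })
    ... | _ , _ , _ , s | inj₁ s<c = _ , _ , _ , low s<c s
    ... | _ , _ , _ , s | inj₂ c<s = _ , _ , _ , high c<s s

    -- The pattern σ tells which word supplies the next letter. By `ls-whole` that car parks in the
    -- shuffle where it parks in its own word, hence on the side that σ prescribes.
    shuffle : ∀ {W₁ U₁ V₁} σ U V → Parts c (ℤ._< c) (c ℤ.<_) W₁ U₁ V₁ →
      #true σ ≡ length U → #false σ ≡ length V →
      ⟦ park (U₁ ++ U) ⟧ ⊆ (ℤ._< c) → ⟦ park (V₁ ++ V) ⟧ ⊆ (c ℤ.<_) →
      ∃[ W₂ ] Split c W₁ σ U V W₂
    shuffle [] [] [] _ _ _ _ _ = [] , []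
    shuffle {W₁} {U₁} {V₁} (true ∷ σ) (a ∷ U) V parts eqU eqV U<c c<V =
      let W₂ , s = shuffle σ U V (Parts-∷ʳ (below c) (above c) parts a s<c)
                     (ℕ.suc-injective eqU) eqV
                     (subst (λ U → ⟦ park U ⟧ ⊆ (ℤ._< c)) (sym (∷ʳ-++ U₁ a U)) U<c) c<V
      in a ∷ W₂ , low s<c s
      where
      s′<c : ls 𝒫 U₁ a ℤ.< c
      s′<c = U<c (ls-parked-++ U₁ a U)
      s<c : ls 𝒫 W₁ a ℤ.< c
      s<c = subst (ℤ._< c) (sym (ls-whole (below c) (above c) parts a s′<c)) s′<c
    shuffle {W₁} {U₁} {V₁} (false ∷ σ) U (a ∷ V) parts eqU eqV U<c c<V =
      let W₂ , s = shuffle σ U V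
                     (Parts-swap (Parts-∷ʳ (above c) (below c) (Parts-swap parts) a c<s))
                     eqU (ℕ.suc-injective eqV) U<c
                     (subst (λ V → ⟦ park V ⟧ ⊆ (c ℤ.<_)) (sym (∷ʳ-++ V₁ a V)) c<V)
      in a ∷ W₂ , high c<s s
      where
      c<s′ : c ℤ.< ls 𝒫 V₁ a
      c<s′ = c<V (ls-parked-++ V₁ a V)
      c<s : c ℤ.< ls 𝒫 W₁ a
      c<s = subst (c ℤ.<_) (sym (ls-whole (above c) (below c) (Parts-swap parts) a c<s′)) c<s′

-- Counting

≐interval? : ∀ k n xs → Dec ((_∈ xs) ≐ interval k n)
≐interval? k n xs with card-interval k n
... | S , (S⊆I , I⊆S) , _ =
  map′ (λ all → All.lookup all) All.tabulate (All.all? [ + suc k ⋯ + (k + n) ]? xs) ×-dec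
  map′ (λ all → All.lookup all ∘ I⊆S) (λ sub → All.tabulate (sub ∘ S⊆I))
       (All.all? (_∈? xs) (elements S))

interval-suc : ∀ {k n x} → interval k n x → interval (suc k) n (ℤ.suc x)
interval-suc (k<x , x≤) = ℤ.suc-mono k<x , ℤ.suc-mono x≤

interval-pred : ∀ {k n x} → interval (suc k) n (ℤ.suc x) → interval k n x
interval-pred {k} {n} {x} (k<x , x≤) =
  subst (+ suc k ℤ.≤_) (ℤ.pred-suc x) (ℤ.pred-mono k<x) ,
  subst (ℤ._≤ + (k + n)) (ℤ.pred-suc x) (ℤ.pred-mono x≤)

interval-below : ∀ {i n} → i ≤ n → interval 0 i ≐ interval 0 (suc n) ∩ (ℤ._< + suc i)
interval-below i≤n =
  (λ (0<x , x≤i) → (0<x , ℤ.≤-trans x≤i (ℤ.+≤+ (ℕ.m≤n⇒m≤1+n i≤n))) , ℤ.≤-<-trans x≤i (i<suc[i] _)) ,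
  (λ ((0<x , _) , x<c) → 0<x , i<suc[j]⇒i≤j x<c)

interval-above : ∀ i j → interval (suc i) j ≐ interval 0 (suc (i + j)) ∩ (+ suc i ℤ.<_)
interval-above i j =
  (λ (c<x , x≤) → (ℤ.≤-trans (ℤ.+≤+ (s≤s z≤n)) c<x , x≤) , ℤ.suc[i]≤j⇒i<j c<x) ,
  (λ ((_ , x≤) , c<x) → ℤ.i<j⇒suc[i]≤j c<x , x≤)

#true+#false : ∀ σ → #true σ + #false σ ≡ length σ
#true+#false []          = refl
#true+#false (true  ∷ σ) = cong suc (#true+#false σ)
#true+#false (false ∷ σ) = trans (ℕ.+-suc (#true σ) (#false σ)) (cong suc (#true+#false σ))

length-∷ʳ : ∀ {A : Set} (xs : List A) x → length (xs ∷ʳ x) ≡ suc (length xs)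
length-∷ʳ xs x = trans (length-++ xs) (ℕ.+-comm (length xs) 1)

τ-word-pred : ∀ W → τ-word (map ℤ.pred W) ≡ W
τ-word-pred W = trans (sym (map-∘ W)) (trans (map-cong ℤ.suc-pred W) (map-id W))

-- Finiteness and shift invariance of the counts

module Enumeration (𝒫 : ParkingProcedure) where
  open ParkingProcedure 𝒫
  open Parking 𝒫

  ParksAt : ℕ → ℕ → Pred Word 0ℓ
  ParksAt k n W = length W ≡ n × ⟦ park W ⟧ ≐ interval k n

  -- The offset `k` is there because left bumps are used for the cars above the last spot, while
  -- right bumps concern only the cars below it, which fill an initial interval.
  BumpsLeft : ℕ → ℕ → Pred (Word × ℤ) 0ℓ
  BumpsLeft k n = (ParksAt k n ⟨×⟩ interval k n) ∩ λ (W , a) → ls 𝒫 W a ≡ + k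

  -- A preferred spot is either occupied already or taken by the car. Hence the letters of a parking
  -- function of length n lie in {1,...,n}, which makes their number finite.
  letters-parked : ∀ W₁ W₂ → All ⟦ park (W₁ ++ W₂) ⟧ W₂
  letters-parked W₁ []       = []
  letters-parked W₁ (a ∷ W₂) =
    subst (λ W → All ⟦ park W ⟧ (a ∷ W₂)) (∷ʳ-++ W₁ a W₂)
      (park-++ (W₁ ∷ʳ a) W₂ a-parked ∷ letters-parked (W₁ ∷ʳ a) W₂)
    where
    a-parked : ⟦ park (W₁ ∷ʳ a) ⟧ a
    a-parked with a ∈? elements (park W₁)
    ... | yes a∈ = monotone W₁ a a∈
    ... | no a∉  = proj₂ (lucky W₁ a a∉) (inj₂ refl)

  card-ParksAt-0 : ∀ n → ∃[ p ] HasCardinality (ParksAt 0 n) p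
  card-ParksAt-0 n with card-filter {Q = λ W → ⟦ park W ⟧ ≐ interval 0 n}
                          (λ W → ≐interval? 0 n (elements (park W)))
                          (card-words {P = interval 0 n} (card-interval 0 n) n)
  ... | p , cp = p , card-resp-≐
    ((λ ((eq , _) , P≐I) → eq , P≐I) ,
     (λ {W} (eq , P≐I) →
       (eq , All.map {Q = interval 0 n} (λ x∈ → proj₁ P≐I x∈) (letters-parked [] W)) , P≐I)) cp

  module _ (shiftInvariant : ShiftInvariant 𝒫) where

    park-τ⁺ : ∀ W {x} → ⟦ park W ⟧ x → ⟦ park (τ-word W) ⟧ (ℤ.suc x)
    park-τ⁺ W x∈ = proj₂ (shiftInvariant W) (∈-map⁺ ℤ.suc x∈)

    park-τ⁻ : ∀ W {x} → ⟦ park (τ-word W) ⟧ (ℤ.suc x) → ⟦ park W ⟧ x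
    park-τ⁻ W x∈ with ∈-map⁻ ℤ.suc (proj₁ (shiftInvariant W) x∈)
    ... | y , y∈ , eq = subst ⟦ park W ⟧ (sym (suc-injective eq)) y∈

    ls-τ : ∀ W a → ls 𝒫 (τ-word W) (ℤ.suc a) ≡ ℤ.suc (ls 𝒫 W a)
    ls-τ W a = ls-unique (τ-word W) (ℤ.suc a)
      (subst (λ V → ⟦ park V ⟧ (ℤ.suc (ls 𝒫 W a))) (map-++ ℤ.suc W (a ∷ []))
        (park-τ⁺ (W ∷ʳ a) (ls-parked W a)))
      (ls-free W a ∘ park-τ⁻ W)

    ParksAt-τ⁺ : ∀ {k n W} → ParksAt k n W → ParksAt (suc k) n (τ-word W)
    ParksAt-τ⁺ {k} {n} {W} (eq , P⊆I , I⊆P) = trans (length-map ℤ.suc W) eq , to , from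
      where
      to : ⟦ park (τ-word W) ⟧ ⊆ interval (suc k) n
      to x∈ with ∈-map⁻ ℤ.suc (proj₁ (shiftInvariant W) x∈)
      ... | y , y∈ , refl = interval-suc {k} (P⊆I y∈)
      from : interval (suc k) n ⊆ ⟦ park (τ-word W) ⟧
      from {x} x∈ = subst ⟦ park (τ-word W) ⟧ (ℤ.suc-pred x)
        (park-τ⁺ W {ℤ.pred x}
          (I⊆P (interval-pred {k} (subst (interval (suc k) n) (sym (ℤ.suc-pred x)) x∈))))

    ParksAt-τ⁻ : ∀ {k n W} → ParksAt (suc k) n (τ-word W) → ParksAt k n W
    ParksAt-τ⁻ {k} {n} {W} (eq , P⊆I , I⊆P) = trans (sym (length-map ℤ.suc W)) eq ,
      (λ x∈ → interval-pred {k} (P⊆I (park-τ⁺ W x∈))) ,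
      (λ x∈ → park-τ⁻ W (I⊆P (interval-suc {k} x∈)))

    card-ParksAt : ∀ {n p} k → HasCardinality (ParksAt 0 n) p → HasCardinality (ParksAt k n) p
    card-ParksAt zero    cp = cp
    card-ParksAt (suc k) cp = card-image τ-word (map-injective suc-injective) ParksAt-τ⁺
      (λ {W} w → map ℤ.pred W ,
        ParksAt-τ⁻ (subst (ParksAt (suc k) _) (sym (τ-word-pred W)) w) , τ-word-pred W)
      (card-ParksAt k cp)

    card-BumpsLeft : ∀ {n l} k → HasCardinality (BumpsLeft 0 n) l → HasCardinality (BumpsLeft k n) l
    card-BumpsLeft zero    cl = cl
    card-BumpsLeft {n} (suc k) cl = card-image {Q = BumpsLeft (suc k) n} shift shift-injective
      (λ {(W , a)} ((w , a∈) , eq) →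
        (ParksAt-τ⁺ w , interval-suc {k} a∈) , trans (ls-τ W a) (cong ℤ.suc eq))
      unshift (card-BumpsLeft k cl)
      where
      shift : Word × ℤ → Word × ℤ
      shift (W , a) = τ-word W , ℤ.suc a
      shift-injective : ∀ {x y} → shift x ≡ shift y → x ≡ y
      shift-injective eq = cong₂ _,_ (map-injective suc-injective (cong proj₁ eq))
                                     (suc-injective (cong proj₂ eq))
      shifted : ∀ x → BumpsLeft (suc k) n (shift x) → BumpsLeft k n x
      shifted (W , a) ((w , a∈) , eq) =
        (ParksAt-τ⁻ w , interval-pred {k} a∈) , suc-injective (trans (sym (ls-τ W a)) eq)
      unshift : ∀ {y} → BumpsLeft (suc k) n y → ∃[ x ] BumpsLeft k n x × shift x ≡ y
      unshift {W , a} b = x , shifted x (subst (BumpsLeft (suc k) n) (sym eq) b) , eq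
        where
        x : Word × ℤ
        x = map ℤ.pred W , ℤ.pred a
        eq : shift x ≡ (W , a)
        eq = cong₂ _,_ (τ-word-pred W) (ℤ.suc-pred a)

-- Cutting a parking function at the spot of its last car

module Count (𝒫 : ParkingProcedure) (bilateral : Bilateral 𝒫) (local : Local 𝒫) where
  open ParkingProcedure 𝒫
  open Parking 𝒫
  open Enumeration 𝒫
  open BilateralLocal 𝒫 bilateral (proj₂ local)
  open Subword

  BumpsRight : ℕ → Pred (Word × ℤ) 0ℓ
  BumpsRight n = (ParksAt 0 n ⟨×⟩ interval 0 n) ∩ λ (W , a) → ls 𝒫 W a ≡ + suc n

  bump : ∀ {n W a} → ParksAt 0 n W → interval 0 n a → ls 𝒫 W a ≡ + 0 ⊎ ls 𝒫 W a ≡ + suc n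
  bump {n} {W} {a} (_ , P⊆I , I⊆P) (0<a , a≤n) = bilateral W a (+ 1) (+ n) (Run.isBlock record
    { nonempty  = ℤ.≤-trans 0<a a≤n
    ; contained = I⊆P
    ; gap-left  = λ 0∈ → contradiction (proj₁ (P⊆I 0∈)) λ { (ℤ.+≤+ ()) }
    ; gap-right = λ 1+n∈ → contradiction (proj₂ (P⊆I 1+n∈)) (ℤ.<⇒≱ (i<suc[i] (+ n)))
    }) (0<a , a≤n)

  -- Neither number is computed: by `bump` every pair is of exactly one kind, and the recurrence
  -- uses only the sum.
  bump-counts : ∀ {p} n → HasCardinality (ParksAt 0 n) p → ∃[ r ] ∃[ l ]
    r + l ≡ p * n × HasCardinality (BumpsRight n) r × HasCardinality (BumpsLeft 0 n) l
  bump-counts n cp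
    with card-split (λ (W , a) → ls 𝒫 W a ℤ.≟ + suc n) (card-× cp (card-interval 0 n))
  ... | r , l , eq , cr , cl = r , l , eq , cr , card-resp-≐ (to , from) cl
    where
    to : (ParksAt 0 n ⟨×⟩ interval 0 n) ∩ ∁ (λ (W , a) → ls 𝒫 W a ≡ + suc n) ⊆
         BumpsLeft 0 n
    to {W , a} ((w , a∈) , ≢n) with bump w a∈
    ... | inj₁ ≡0 = (w , a∈) , ≡0
    ... | inj₂ ≡n = contradiction ≡n ≢n
    from : BumpsLeft 0 n ⊆
           (ParksAt 0 n ⟨×⟩ interval 0 n) ∩ ∁ (λ (W , a) → ls 𝒫 W a ≡ + suc n)
    from ((w , a∈) , ≡0) = (w , a∈) , λ ≡n → contradiction (trans (sym ≡0) ≡n) λ ()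

  -- The data determining, besides the interleaving of the two sides, a parking function of
  -- length i + j + 1 whose last car has preference a and fills the remaining spot i + 1.
  Filling : ℕ → ℕ → Pred (Word × Word × ℤ) 0ℓ
  Filling i j (U , V , a) = ParksAt 0 i U × ParksAt (suc i) j V ×
    (a ≡ + suc i ⊎ (interval 0 i a × ls 𝒫 U a ≡ + suc i) ⊎
                   (interval (suc i) j a × ls 𝒫 V a ≡ + suc i))

  -- One summand for each kind of preference: the spot i + 1 itself, a spot below it, a spot above
  -- it. Shift invariance lets the counts for the upper block be taken at offset 0.
  card-Filling : ∀ {p q r l} i j → HasCardinality (ParksAt 0 i) p → HasCardinality (ParksAt 0 j) q →
    HasCardinality (BumpsRight i) r → HasCardinality (BumpsLeft 0 j) l →
    HasCardinality (Filling i j) ((p * q + r * q) + p * l)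
  card-Filling i j cp cq₀ cr cl₀ = card-resp-≐ (to , from)
    (card-∪
      (card-∪ cExact cRight
        λ (_ , _ , eq) (_ , _ , a∈ , _) → c∉below (subst (interval 0 i) eq a∈))
      cLeft λ { (inj₁ (_ , _ , eq)) (_ , (_ , a∈) , _) → c∉above (subst (interval (suc i) j) eq a∈)
              ; (inj₂ (_ , _ , a∈ , _)) (_ , (_ , a∈′) , _) → below-above a∈ a∈′ })
    where
    c∉below : ¬ interval 0 i (+ suc i)
    c∉below (_ , c≤i) = ℤ.<⇒≱ (i<suc[i] (+ i)) c≤i
    c∉above : ¬ interval (suc i) j (+ suc i)
    c∉above (c<c , _) = ℤ.<⇒≱ (i<suc[i] (+ suc i)) c<c
    below-above : ∀ {a} → interval 0 i a → ¬ interval (suc i) j a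
    below-above (_ , a≤i) (c<a , _) =
      ℤ.<⇒≱ (ℤ.<-trans (i<suc[i] (+ i)) (i<suc[i] (+ suc i))) (ℤ.≤-trans c<a a≤i)
    Exact Right Left : Pred (Word × Word × ℤ) 0ℓ
    Exact (U , V , a) = ParksAt 0 i U × ParksAt (suc i) j V × a ≡ + suc i
    Right (U , V , a) = ParksAt 0 i U × ParksAt (suc i) j V × interval 0 i a × ls 𝒫 U a ≡ + suc i
    Left = ParksAt 0 i ⟨×⟩ BumpsLeft (suc i) j
    cq : HasCardinality (ParksAt (suc i) j) _
    cq = card-ParksAt (proj₁ local) (suc i) cq₀
    cExact : HasCardinality Exact _
    cExact = card-image {P = ParksAt 0 i ⟨×⟩ ParksAt (suc i) j} {Q = Exact}
      (λ (U , V) → U , V , + suc i) (λ { refl → refl })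
      (λ (u , v) → u , v , refl) (λ { {U , V , _} (u , v , refl) → (U , V) , (u , v) , refl })
      (card-× cp cq)
    cRight : HasCardinality Right _
    cRight = card-image {P = BumpsRight i ⟨×⟩ ParksAt (suc i) j} {Q = Right}
      (λ ((U , a) , V) → U , V , a) (λ { refl → refl })
      (λ (((u , a∈) , eq) , v) → u , v , a∈ , eq)
      (λ { {U , V , a} (u , v , a∈ , eq) → ((U , a) , V) , (((u , a∈) , eq) , v) , refl })
      (card-× cr cq)
    cLeft : HasCardinality Left _
    cLeft = card-× cp (card-BumpsLeft (proj₁ local) (suc i) cl₀)
    to : (Exact ∪ Right) ∪ Left ⊆ Filling i j
    to (inj₁ (inj₁ (u , v , eq)))          = u , v , inj₁ eq
    to (inj₁ (inj₂ (u , v , a∈ , eq)))     = u , v , inj₂ (inj₁ (a∈ , eq))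
    to (inj₂ (u , (v , a∈) , eq))          = u , v , inj₂ (inj₂ (a∈ , eq))
    from : Filling i j ⊆ (Exact ∪ Right) ∪ Left
    from (u , v , inj₁ eq)                 = inj₁ (inj₁ (u , v , eq))
    from (u , v , inj₂ (inj₁ (a∈ , eq)))   = inj₁ (inj₂ (u , v , a∈ , eq))
    from (u , v , inj₂ (inj₂ (a∈ , eq)))   = inj₂ (u , (v , a∈) , eq)

  -- The cutting spot need not be stored, since the cars below it fill {1,...,i} and i is the number
  -- of entries `true` in σ.
  Assembles : List Bool × Word × Word × ℤ → Word → Set
  Assembles (σ , U , V , a) W′ = ∃[ W ] W′ ≡ W ∷ʳ a × ls 𝒫 W a ≡ + suc (#true σ) ×
                                        Split (+ suc (#true σ)) [] σ U V W

  -- The word determines its last letter and the spot of its last car, so both splittings are made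
  -- at the same spot.
  Assembles-injective : ∀ {x y W} → Assembles x W → Assembles y W → x ≡ y
  Assembles-injective {_ , _ , _ , _} {σ , U , V , _} (W , refl , c , s) (W′ , eq , c′ , s′)
    with ∷ʳ-injective W W′ eq
  ... | refl , refl with Split-injective s
          (subst (λ d → Split d [] σ U V W) (trans (sym c′) c) s′)
  ...   | refl , refl , refl = refl

  Assembles-functional : ∀ {x W W′} → Assembles x W → Assembles x W′ → W ≡ W′
  Assembles-functional {_ , _ , _ , a} (_ , refl , _ , s) (_ , refl , _ , s′) =
    cong (_∷ʳ a) (Split-functional s s′)

  module _ {c : ℤ} {W U V : Word} (parts : Parts c (ℤ._< c) (c ℤ.<_) W U V) where
    open Parts parts

    ls-below : ∀ {a} → ⟦ park U ⟧ a → ls 𝒫 W a ≡ ls 𝒫 U a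
    ls-below a∈U = proj₁ (ls-Subword (below c) c∉W U⊑W a∈U)

    ls-above : ∀ {a} → ⟦ park V ⟧ a → ls 𝒫 W a ≡ ls 𝒫 V a
    ls-above a∈V = proj₁ (ls-Subword (above c) c∉W V⊑W a∈V)

    park-parts : ∀ {x} → ⟦ park W ⟧ x → ⟦ park U ⟧ x ⊎ ⟦ park V ⟧ x
    park-parts {x} x∈W with HalfLine.total (below c) {x} (λ { refl → c∉W x∈W })
    ... | inj₁ x<c = inj₁ (proj₂ (park≐ U⊑W) (x∈W , x<c))
    ... | inj₂ c<x = inj₂ (proj₂ (park≐ V⊑W) (x∈W , c<x))

  assemble : ∀ {n x} → WithSteps n Filling x → ∃[ W ] ParksAt 0 (suc n) W × Assembles x W
  assemble {x = σ , U , V , a} (refl , (|U| , U⊆ , ⊆U) , (|V| , V⊆ , ⊆V) , pref) =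
    W ∷ʳ a , (trans (length-∷ʳ W a) (cong suc (sym |σ|)) , to , from) , W , refl , ls≡c , s
    where
    i j N : ℕ
    i = #true σ
    j = #false σ
    N = length σ
    c : ℤ
    c = + suc i
    i+j≡N : i + j ≡ N
    i+j≡N = #true+#false σ
    i≤N : i ≤ N
    i≤N = subst (i ≤_) i+j≡N (ℕ.m≤m+n i j)
    above-n : interval (suc i) j ≐ interval 0 (suc N) ∩ (c ℤ.<_)
    above-n = subst (λ k → interval (suc i) j ≐ interval 0 (suc k) ∩ (c ℤ.<_)) i+j≡N
                (interval-above i j)
    shuffled : ∃[ W ] Split c [] σ U V W
    shuffled = shuffle σ U V Parts-[] (sym |U|) (sym |V|)
      (proj₂ ∘ proj₁ (interval-below i≤N) ∘ U⊆) (proj₂ ∘ proj₁ (interval-above i j) ∘ V⊆)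
    W : Word
    W = proj₁ shuffled
    s : Split c [] σ U V W
    s = proj₂ shuffled
    |σ| : N ≡ length W
    |σ| = proj₁ (Split-lengths s)
    parts : Parts c (ℤ._< c) (c ℤ.<_) W U V
    parts = Split-Parts Parts-[] s
    open Parts parts
    ls≡c : ls 𝒫 W a ≡ c
    -- A preference for the free spot is granted. A bump off `U` or `V` has the same outcome in the
    -- shuffled word, as the other side has no influence.
    ls≡c = [ (λ a≡c → trans (ls-lucky W a (subst (¬_ ∘ ⟦ park W ⟧) (sym a≡c) c∉W)) a≡c)
           , [ (λ (a∈ , eq) → trans (ls-below parts (⊆U a∈)) eq)
             , (λ (a∈ , eq) → trans (ls-above parts (⊆V a∈)) eq) ]′ ]′ pref
    to : ⟦ park (W ∷ʳ a) ⟧ ⊆ interval 0 (suc N)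
    to x∈ with proj₁ (park-∷ʳ W a) x∈
    ... | inj₂ refl rewrite ls≡c = ℤ.+≤+ (s≤s z≤n) , ℤ.+≤+ (s≤s i≤N)
    ... | inj₁ x∈W with park-parts parts x∈W
    ...   | inj₁ x∈U = proj₁ (proj₁ (interval-below i≤N) (U⊆ x∈U))
    ...   | inj₂ x∈V = proj₁ (proj₁ above-n (V⊆ x∈V))
    from : interval 0 (suc N) ⊆ ⟦ park (W ∷ʳ a) ⟧
    from {x} x∈ with x ℤ.≟ c
    ... | yes refl = subst ⟦ park (W ∷ʳ a) ⟧ ls≡c (ls-parked W a)
    ... | no x≢c with HalfLine.total (below c) x≢c
    ...   | inj₁ x<c =
      monotone W a (proj₁ (proj₁ (park≐ U⊑W) (⊆U (proj₂ (interval-below i≤N) (x∈ , x<c)))))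
    ...   | inj₂ c<x = monotone W a (proj₁ (proj₁ (park≐ V⊑W) (⊆V (proj₂ above-n (x∈ , c<x)))))

  disassemble-at : ∀ {n} i W a → ls 𝒫 W a ≡ + suc i → i ≤ n → ParksAt 0 (suc n) (W ∷ʳ a) →
    ∃[ x ] WithSteps n Filling x × Assembles x (W ∷ʳ a)
  disassemble-at {n} i W a ls≡c i≤n (|Wa| , P⊆I , I⊆P)
    with split {+ suc i} [] W (subst (¬_ ∘ ⟦ park W ⟧) ls≡c (ls-free W a))
  ... | σ , U , V , s with Split-Parts Parts-[] s | Split-lengths s
  ... | parts | |σ| , #t , _ = finish σ #true≡i |σ|≡n s
    where
    open Parts parts
    c : ℤ
    c = + suc i
    |σ|≡n : length σ ≡ n
    |σ|≡n = trans |σ| (ℕ.suc-injective (trans (sym (length-∷ʳ W a)) |Wa|))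
    parked : ∀ {x} → interval 0 (suc n) x → x ≢ c → ⟦ park W ⟧ x
    parked x∈ x≢c with proj₁ (park-∷ʳ W a) (I⊆P x∈)
    ... | inj₁ x∈W  = x∈W
    ... | inj₂ refl = contradiction ls≡c x≢c
    U≐ : ⟦ park U ⟧ ≐ interval 0 i
    U≐ = (λ x∈U → let x∈W , x<c = proj₁ (park≐ U⊑W) x∈U in
                  proj₂ (interval-below i≤n) (P⊆I (monotone W a x∈W) , x<c)) ,
         (λ x∈I → let x∈ , x<c = proj₁ (interval-below i≤n) x∈I in
                  proj₂ (park≐ U⊑W) (parked x∈ (ℤ.<⇒≢ x<c) , x<c))
    |U|≡i : length U ≡ i
    -- The number of letters of `U` is found by counting the spots they fill.
    |U|≡i = trans (sym (card U)) (card-unique (park U , U≐ , refl) (card-interval 0 i))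
    #true≡i : #true σ ≡ i
    #true≡i = trans #t |U|≡i
    V≐ : ∀ j → i + j ≡ n → ⟦ park V ⟧ ≐ interval (suc i) j
    V≐ j refl =
      (λ x∈V → let x∈W , c<x = proj₁ (park≐ V⊑W) x∈V in
               proj₂ (interval-above i j) (P⊆I (monotone W a x∈W) , c<x)) ,
      (λ x∈I → let x∈ , c<x = proj₁ (interval-above i j) x∈I in
               proj₂ (park≐ V⊑W) (parked x∈ (ℤ.<⇒≢ c<x ∘ sym) , c<x))
    -- The pattern is quantified anew, so that the equations for `i` and `n` can be matched with
    -- `refl`.
    finish : ∀ σ → #true σ ≡ i → length σ ≡ n → Split c [] σ U V W →
             ∃[ x ] WithSteps n Filling x × Assembles x (W ∷ʳ a)
    finish σ refl refl s =
      (σ , U , V , a) ,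
      (refl , (|U|≡i , U≐) , (sym (proj₂ (proj₂ (Split-lengths s))) , V≐j) , pref) ,
      W , refl , ls≡c , s
      where
      V≐j : ⟦ park V ⟧ ≐ interval (suc i) (#false σ)
      V≐j = V≐ (#false σ) (#true+#false σ)
      pref : a ≡ c ⊎ (interval 0 i a × ls 𝒫 U a ≡ c) ⊎
                     (interval (suc i) (#false σ) a × ls 𝒫 V a ≡ c)
      pref with a ∈? elements (park W)
      ... | no a∉W = inj₁ (trans (sym (ls-lucky W a a∉W)) ls≡c)
      ... | yes a∈W with park-parts parts a∈W
      ...   | inj₁ a∈U = inj₂ (inj₁ (proj₁ U≐ a∈U , trans (sym (ls-below parts a∈U)) ls≡c))
      ...   | inj₂ a∈V = inj₂ (inj₂ (proj₁ V≐j a∈V , trans (sym (ls-above parts a∈V)) ls≡c))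

  disassemble : ∀ {n W} → ParksAt 0 (suc n) W → ∃[ x ] WithSteps n Filling x × Assembles x W
  disassemble {W = W} w with initLast W
  disassemble (() , _) | []
  -- The last car parks in {1,...,n + 1}, so its spot has the form i + 1 with i ≤ n.
  disassemble w@(_ , P⊆I , _) | W ∷ʳ′ a with ls 𝒫 W a in eq | P⊆I (ls-parked W a)
  ... | + suc i | ℤ.+≤+ _ , ℤ.+≤+ (s≤s i≤n) = disassemble-at i W a eq i≤n w
  ... | + zero  | ℤ.+≤+ () , _

  card-ParksAt-suc : ∀ n {f} → (∀ i j → HasCardinality (Filling i j) (f i j)) →
    HasCardinality (ParksAt 0 (suc n)) (binomialSum n f)
  card-ParksAt-suc n cf = card-transport Assembles Assembles-injective
    {P = WithSteps n Filling} Assembles-functional assemble disassemble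
    (card-binomialSum n Filling cf)

  -- The recurrence and its solution

  p r l : ℕ → ℕ
  p n = proj₁ (card-ParksAt-0 n)
  r n = proj₁ (bump-counts n (proj₂ (card-ParksAt-0 n)))
  l n = proj₁ (proj₂ (bump-counts n (proj₂ (card-ParksAt-0 n))))

  r+l : ∀ n → r n + l n ≡ p n * n
  r+l n = proj₁ (proj₂ (proj₂ (bump-counts n (proj₂ (card-ParksAt-0 n)))))

  p-zero : p 0 ≡ 1
  p-zero = card-unique (proj₂ (card-ParksAt-0 0)) (card-singleton {P = ParksAt 0 0}
    (refl , (λ x∈ → contradiction x∈ (proj₁ park-ε)) ,
            (λ (0<x , x≤0) → contradiction (ℤ.≤-trans 0<x x≤0) λ { (ℤ.+≤+ ()) }))
    λ { {[]} _ → refl })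

  p-suc : ∀ n → p (suc n) ≡ binomialSum n λ i j → suc i * p i * p j
  p-suc n = begin
    p (suc n)
      ≡⟨ card-unique (proj₂ (card-ParksAt-0 (suc n))) (card-ParksAt-suc n λ i j →
           let _ , _ , _ , cr , _ = bump-counts i (proj₂ (card-ParksAt-0 i))
               _ , _ , _ , _ , cl = bump-counts j (proj₂ (card-ParksAt-0 j))
           in card-Filling i j (proj₂ (card-ParksAt-0 i)) (proj₂ (card-ParksAt-0 j)) cr cl) ⟩
    binomialSum n (λ i j → f i j + p i * l j)
      ≡⟨ binomialSum-+ n f (λ i j → p i * l j) ⟩
    binomialSum n f + binomialSum n (λ i j → p i * l j)
      -- Exchanging i and j in the sum over left bumps puts `l i` next to `r i`, with the common
      -- factor `p j`; only their sum i · p(i) is known.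
      ≡⟨ cong (λ s → binomialSum n f + s) (binomialSum-swap n λ i j → p j * l i) ⟩
    binomialSum n f + binomialSum n (λ i j → p j * l i)
      ≡⟨ sym (binomialSum-+ n f λ i j → p j * l i) ⟩
    binomialSum n (λ i j → f i j + p j * l i)
      ≡⟨ binomialSum-cong n (λ i j _ → begin
           p i * p j + r i * p j + p j * l i
             ≡⟨ collect (p i) (p j) (r i) (l i) ⟩
           (p i + (r i + l i)) * p j
             ≡⟨ cong (λ s → (p i + s) * p j) (trans (r+l i) (ℕ.*-comm (p i) i)) ⟩
           suc i * p i * p j ∎) ⟩
    binomialSum n (λ i j → suc i * p i * p j) ∎
    where
    f : ℕ → ℕ → ℕ
    f i j = p i * p j + r i * p j
    collect : ∀ pᵢ pⱼ rᵢ lᵢ →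
      pᵢ * pⱼ + rᵢ * pⱼ + pⱼ * lᵢ ≡ (pᵢ + (rᵢ + lᵢ)) * pⱼ
    collect = solve-∀

  -- Strong induction, as the recurrence involves all smaller lengths. The factor (i + 1) turns the
  -- closed form of p(i) into (i + 1)^i, so that the recurrence becomes Abel's sum at x = y = 1.
  p-closed : ∀ n → p n ≡ abelPoly n 1
  p-closed = <-rec _ step
    where
    suc-abelPoly : ∀ i → suc i * abelPoly i 1 ≡ suc i ^ i
    suc-abelPoly i = trans (abelPoly-* i 1) (ℕ.*-identityˡ _)
    step : ∀ n → (∀ {m} → m < n → p m ≡ abelPoly m 1) → p n ≡ abelPoly n 1
    step zero    _  = p-zero
    step (suc n) ih = begin
      p (suc n)
        ≡⟨ p-suc n ⟩
      binomialSum n (λ i j → suc i * p i * p j)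
        ≡⟨ binomialSum-cong n (λ { i j refl → cong₂ _*_
             (trans (cong (suc i *_) (ih (s≤s (ℕ.m≤m+n i j)))) (suc-abelPoly i))
             (ih (s≤s (ℕ.m≤n+m j i))) }) ⟩
      abelSum n 1 1
        ≡⟨ abel-identity n 1 1 ⟩
      (1 + suc n) ^ n
        ≡⟨ sym (ℕ.*-identityˡ _) ⟩
      abelPoly (suc n) 1 ∎

  card-parkingFunctions : ∀ n →
    HasCardinality (λ W → length W ≡ n × IsParkingFunction 𝒫 W) (abelPoly n 1)
  card-parkingFunctions n = card-resp-≐
    ((λ { (refl , P≐I) → refl , P≐I }) , (λ { (refl , P≐I) → refl , P≐I }))
    (subst (HasCardinality (ParksAt 0 n)) (p-closed n) (proj₂ (card-ParksAt-0 n)))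

theorem1p1 : (𝒫 : ParkingProcedure) → Bilateral 𝒫 → Local 𝒫 →
    (r : ℕ) → r ≥ 1 →
    HasCardinality (λ W → length W ≡ r × IsParkingFunction 𝒫 W) ((r + 1) ^ (r ∸ 1))
theorem1p1 𝒫 bilateral local (suc n) _ =
  subst (HasCardinality _) (trans (ℕ.*-identityˡ _) (cong (_^ n) (ℕ.+-comm 1 (suc n))))
    (Count.card-parkingFunctions 𝒫 bilateral local (suc n))
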